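{- Assume the Exponential Time Hypothesis (ETH). Then for every constant $c>0$ and every constant $\varepsilon\in(0,1/8)$ there is no polynomial-time algorithm solving $\mathrm{SAT}(n,2^{\,n-(\log n)^{1+c}})$, even when it is guaranteed that the input is $(7/8+\varepsilon)$-satisfiable.
   Context: $\mathrm{SAT}(n,s)$ denotes the class of SAT instances (CNF formulas) with $n$ variables that are promised to be either unsatisfiable or to have at least $s$ satisfying assignments (out of the $2^n$ assignments to the $n$ variables, which need not all occur in clauses). An algorithm solves $\mathrm{SAT}(n,s)$ if, for every formula in this class, it determines whether the formula is satisfiable or unsatisfiable. A formula is $\alpha$-satisfiable if some assignment satisfies at least an $\alpha$ fraction of its clauses. Polynomial time means polynomial in $n$ and the size of the formula. $\log$ is base $2$. ETH: there is no algorithm deciding 3-SAT on $m$ variables in time $2^{o(m)}$. -}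

module Defs where

open import Data.Bool.Base using (Bool; true; false; not)
open import Data.Bool.ListAction using (any; all)
open import Data.Fin.Base using (Fin; toℕ)
open import Data.Integer.Base using (+_)
open import Data.List.Base using (List; []; _∷_; _++_; map; length; filterᵇ; sum; foldr; replicate)
open import Data.List.Relation.Unary.All using (All)
open import Data.List.Relation.Unary.Unique.Propositional using (Unique)
open import Data.Nat.Base as ℕ using (ℕ; zero; suc; NonZero)
import Data.Nat.Properties as ℕ
open import Data.Product.Base using (∃; _×_; _,_)
open import Data.Rational.Base as ℚ using (ℚ; 0ℚ; _/_)
import Data.Rational.Properties as ℚ
open import Data.Sum.Base using (_⊎_)
open import Data.Vec.Base as Vec using (Vec)
open import Function.Base using (_∘_)
open import Function.Bundles using (_⇔_; mk⇔; module Equivalence)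
open import Relation.Binary.PropositionalEquality
  using (_≡_; _≢_; refl; sym; trans; cong; subst; module ≡-Reasoning)
open import Relation.Nullary using (¬_; yes; no)

record ℝ : Set₁ where
  field
    lower upper : ℚ → Set                  -- q < x  and  x < q
    inhabitedˡ  : ∃ lower
    inhabitedᵘ  : ∃ upper
    roundedˡ    : ∀ q → lower q ⇔ (∃ λ r → q ℚ.< r × lower r)
    roundedᵘ    : ∀ q → upper q ⇔ (∃ λ r → r ℚ.< q × upper r)
    disjoint    : ∀ q → ¬ (lower q × upper q)
    located     : ∀ {q r} → q ℚ.< r → lower q ⊎ upper r

open ℝ public

infix 4 _ℚ<ℝ_ _ℝ<ℚ_

_ℚ<ℝ_ : ℚ → ℝ → Set
q ℚ<ℝ x = lower x q

_ℝ<ℚ_ : ℝ → ℚ → Set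
x ℝ<ℚ q = upper x q

private
  -‿+ : ∀ q s → (s ℚ.- q) ℚ.+ q ≡ s
  -‿+ q s = begin
    (s ℚ.- q) ℚ.+ q         ≡⟨ ℚ.+-assoc s (ℚ.- q) q ⟩
    s ℚ.+ ((ℚ.- q) ℚ.+ q)   ≡⟨ cong (s ℚ.+_) (ℚ.+-inverseˡ q) ⟩
    s ℚ.+ 0ℚ                ≡⟨ ℚ.+-identityʳ s ⟩
    s                       ∎
    where open ≡-Reasoning

  +‿- : ∀ q s → (s ℚ.+ q) ℚ.- q ≡ s
  +‿- q s = begin
    (s ℚ.+ q) ℚ.- q         ≡⟨ ℚ.+-assoc s q (ℚ.- q) ⟩
    s ℚ.+ (q ℚ.- q)         ≡⟨ cong (s ℚ.+_) (ℚ.+-inverseʳ q) ⟩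
    s ℚ.+ 0ℚ                ≡⟨ ℚ.+-identityʳ s ⟩
    s                       ∎
    where open ≡-Reasoning

  -‿mono : ∀ q {s t} → s ℚ.< t → s ℚ.- q ℚ.< t ℚ.- q
  -‿mono q = ℚ.+-monoˡ-< (ℚ.- q)

  +‿mono : ∀ q {s t} → s ℚ.< t → s ℚ.+ q ℚ.< t ℚ.+ q
  +‿mono q = ℚ.+-monoˡ-< q

infixl 6 _⊕_

_⊕_ : ℚ → ℝ → ℝ
(q ⊕ x) .lower s = lower x (s ℚ.- q)
(q ⊕ x) .upper s = upper x (s ℚ.- q)
(q ⊕ x) .inhabitedˡ with inhabitedˡ x
... | s , s<x = s ℚ.+ q , subst (lower x) (sym (+‿- q s)) s<x
(q ⊕ x) .inhabitedᵘ with inhabitedᵘ x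
... | s , x<s = s ℚ.+ q , subst (upper x) (sym (+‿- q s)) x<s
(q ⊕ x) .roundedˡ s = mk⇔
  (λ s<x → let (r , s<r , r<x) = Equivalence.to (roundedˡ x (s ℚ.- q)) s<x in
    r ℚ.+ q , subst (ℚ._< r ℚ.+ q) (-‿+ q s) (+‿mono q s<r)
            , subst (lower x) (sym (+‿- q r)) r<x)
  (λ (r , s<r , r<x) →
    Equivalence.from (roundedˡ x (s ℚ.- q)) (r ℚ.- q , -‿mono q s<r , r<x))
(q ⊕ x) .roundedᵘ s = mk⇔
  (λ x<s → let (r , r<s , x<r) = Equivalence.to (roundedᵘ x (s ℚ.- q)) x<s in
    r ℚ.+ q , subst (r ℚ.+ q ℚ.<_) (-‿+ q s) (+‿mono q r<s)
            , subst (upper x) (sym (+‿- q r)) x<r)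
  (λ (r , r<s , x<r) →
    Equivalence.from (roundedᵘ x (s ℚ.- q)) (r ℚ.- q , -‿mono q r<s , x<r))
(q ⊕ x) .disjoint s = disjoint x (s ℚ.- q)
(q ⊕ x) .located s<t = located x (-‿mono q s<t)

-- CNF formulas over n variables, not all of which need to occur.

data Literal (n : ℕ) : Set where
  pos neg : Fin n → Literal n

Clause : ℕ → Set
Clause n = List (Literal n)

CNF : ℕ → Set
CNF n = List (Clause n)

Assignment : ℕ → Set
Assignment n = Vec Bool n

evalLiteral : ∀ {n} → Assignment n → Literal n → Bool
evalLiteral v (pos i) = Vec.lookup v i
evalLiteral v (neg i) = not (Vec.lookup v i)

evalClause : ∀ {n} → Assignment n → Clause n → Bool
evalClause v = any (evalLiteral v)

evalCNF : ∀ {n} → Assignment n → CNF n → Bool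
evalCNF v = all (evalClause v)

Satisfiable : ∀ {n} → CNF n → Set
Satisfiable φ = ∃ λ v → evalCNF v φ ≡ true

assignments : ∀ n → List (Assignment n)
assignments zero    = Vec.[] ∷ []
assignments (suc n) = map (true Vec.∷_) (assignments n) ++ map (false Vec.∷_) (assignments n)

#sat : ∀ {n} → CNF n → ℕ
#sat {n} φ = length (filterᵇ (λ v → evalCNF v φ) (assignments n))

#satisfiedClauses : ∀ {n} → Assignment n → CNF n → ℕ
#satisfiedClauses v φ = length (filterᵇ (evalClause v) φ)

-- A real α satisfies α · |φ| ≤ k iff every rational r < α does.
_-Satisfiable_ : ∀ {n} → ℝ → CNF n → Set
α -Satisfiable φ = ∃ λ v → ∀ r → r ℚ<ℝ α →
  r ℚ.* (+ length φ / 1) ℚ.≤ + #satisfiedClauses v φ / 1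

-- Occurrences of literals plus number of clauses.  The bit length of a
-- formula exceeds this by at most a factor O(log n).
size : ∀ {n} → CNF n → ℕ
size φ = sum (map (suc ∘ length) φ)

-- The standard "no repeated clauses" convention (a formula is a set of
-- clauses) makes the size of a 3-CNF polynomial in its number of variables,
-- so that bounding running times in that number alone is meaningful.
3CNF : ∀ {n} → CNF n → Set
3CNF φ = All (λ C → length C ℕ.≤ 3) φ × Unique φ

-- The threshold s is given by the set of natural numbers N with s ≤ N.
SAT : ∀ n → (ℕ → Set) → CNF n → Set
SAT n s≤ φ = ¬ Satisfiable φ ⊎ s≤ (#sat φ)

-- a / b > log₂ n
Above-log₂ : ℕ → (a b : ℕ) → Set
Above-log₂ n a b = n ℕ.^ b ℕ.< 2 ℕ.^ a

-- (a / b) ^ (1 + p / q) ≤ e / f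
Power≤ : (a b p q e f : ℕ) → Set
Power≤ a b p q e f = a ℕ.^ (p ℕ.+ q) ℕ.* f ℕ.^ q ℕ.≤ e ℕ.^ q ℕ.* b ℕ.^ (p ℕ.+ q)

-- For n ≥ 1 and c > 0, 2 ^ (n - (log₂ n) ^ (1 + c)) ≤ N.  Here
-- (log₂ n) ^ (1 + c) is the infimum of the powers v ^ (1 + r) over the
-- rationals v > log₂ n and r > c (both when n = 1 and when log₂ n ≥ 1), so
-- the inequality says that 2 ^ (n - u) ≤ N for all rationals u above some
-- such power; below, v = a / b, r = p / q and u = e / f.
2^[_-log^1+_]≤_ : ℕ → ℝ → ℕ → Set
2^[ n -log^1+ c ]≤ N =
  ∀ a b p q e f .{{_ : NonZero b}} .{{_ : NonZero q}} .{{_ : NonZero f}} →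
  Above-log₂ n a b → c ℝ<ℚ (+ p / q) → Power≤ a b p q e f →
  2 ℕ.^ (n ℕ.* f) ℕ.≤ N ℕ.^ f ℕ.* 2 ℕ.^ e

-- Algorithms: programs of the language WHILE of N. D. Jones, "Computability
-- and Complexity from a Programming Perspective" (MIT Press, 1997), extended
-- by a conditional.  Its data are binary trees, every elementary operation
-- has unit cost, and data are only tested for being nil.  Since trees can be
-- represented by pointers into a shared heap, to which each step adds O(1)
-- cells, WHILE and Turing machines simulate each other with polynomial
-- overhead.  Hence polynomial time is the usual notion, and so is
-- 2 ^ o(m) on inputs of size polynomial in m.

data D : Set where
  nil : D
  _∙_ : D → D → D

data Expr : Set where
  var   : ℕ → Expr
  nil   : Expr
  cons  : Expr → Expr → Expr
  hd tl : Expr → Expr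

infix  21 _≔_
infixr 20 _⨾_

data Program : Set where
  _≔_           : ℕ → Expr → Program
  _⨾_           : Program → Program → Program
  if_then_else_ : Expr → Program → Program → Program
  while_loop_     : Expr → Program → Program

Store : Set
Store = ℕ → D

_[_↦_] : Store → ℕ → D → Store
(σ [ x ↦ d ]) y with x ℕ.≟ y
... | yes _ = d
... | no  _ = σ y

head tail : D → D
head nil     = nil
head (d ∙ _) = d
tail nil     = nil
tail (_ ∙ e) = e

⟦_⟧ : Expr → Store → D
⟦ var x ⟧    σ = σ x
⟦ nil ⟧      σ = nil
⟦ cons e f ⟧ σ = ⟦ e ⟧ σ ∙ ⟦ f ⟧ σ
⟦ hd e ⟧     σ = head (⟦ e ⟧ σ)
⟦ tl e ⟧     σ = tail (⟦ e ⟧ σ)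

cost : Expr → ℕ
cost (var _)    = 1
cost nil        = 1
cost (cons e f) = suc (cost e ℕ.+ cost f)
cost (hd e)     = suc (cost e)
cost (tl e)     = suc (cost e)

infix 4 ⟨_,_⟩⇓⟨_,_⟩

-- ⟨ P , σ ⟩⇓⟨ τ , t ⟩: started in σ, P halts in τ after time t.
data ⟨_,_⟩⇓⟨_,_⟩ : Program → Store → Store → ℕ → Set where
  assign : ∀ {x e σ} →
    ⟨ x ≔ e , σ ⟩⇓⟨ σ [ x ↦ ⟦ e ⟧ σ ] , suc (cost e) ⟩
  seq : ∀ {P Q σ τ υ s t} →
    ⟨ P , σ ⟩⇓⟨ τ , s ⟩ → ⟨ Q , τ ⟩⇓⟨ υ , t ⟩ →
    ⟨ P ⨾ Q , σ ⟩⇓⟨ υ , s ℕ.+ t ⟩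
  if-true : ∀ {e P Q σ τ t} →
    ⟦ e ⟧ σ ≢ nil → ⟨ P , σ ⟩⇓⟨ τ , t ⟩ →
    ⟨ if e then P else Q , σ ⟩⇓⟨ τ , suc (cost e) ℕ.+ t ⟩
  if-false : ∀ {e P Q σ τ t} →
    ⟦ e ⟧ σ ≡ nil → ⟨ Q , σ ⟩⇓⟨ τ , t ⟩ →
    ⟨ if e then P else Q , σ ⟩⇓⟨ τ , suc (cost e) ℕ.+ t ⟩
  while-true : ∀ {e P σ τ υ s t} →
    ⟦ e ⟧ σ ≢ nil → ⟨ P , σ ⟩⇓⟨ τ , s ⟩ → ⟨ while e loop P , τ ⟩⇓⟨ υ , t ⟩ →
    ⟨ while e loop P , σ ⟩⇓⟨ υ , suc (cost e) ℕ.+ (s ℕ.+ t) ⟩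
  while-false : ∀ {e P σ} →
    ⟦ e ⟧ σ ≡ nil →
    ⟨ while e loop P , σ ⟩⇓⟨ σ , suc (cost e) ⟩

-- Variable 0 holds both the input and the output.
initial : D → Store
initial d zero    = d
initial d (suc _) = nil

-- On input d, the program P halts within time T, and answers "yes" (any
-- output other than nil) exactly when A holds.
Answers : Program → D → ℕ → Set → Set
Answers P d T A = ∃ λ τ → ∃ λ t →
  ⟨ P , initial d ⟩⇓⟨ τ , t ⟩ × t ℕ.≤ T × (τ 0 ≢ nil ⇔ A)

encodeList : List D → D
encodeList = foldr _∙_ nil

encodeℕ : ℕ → D
encodeℕ n = encodeList (replicate n nil)

encodeLiteral : ∀ {n} → Literal n → D
encodeLiteral (pos i) = (nil ∙ nil) ∙ encodeℕ (toℕ i)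
encodeLiteral (neg i) = nil ∙ encodeℕ (toℕ i)

encodeClause : ∀ {n} → Clause n → D
encodeClause = encodeList ∘ map encodeLiteral

-- Unary numerals are harmless, as all time bounds may depend on n.
encode : ∀ {n} → CNF n → D
encode {n} φ = encodeℕ n ∙ encodeList (map encodeClause φ)

o[id] : (ℕ → ℕ) → Set
o[id] f = ∀ k → ∃ λ m₀ → ∀ m → m₀ ℕ.≤ m → k ℕ.* f m ℕ.≤ m

ETH : Set
ETH = ¬ ∃ λ P → ∃ λ f → o[id] f ×
  (∀ m (φ : CNF m) → 3CNF φ → Answers P (encode φ) (2 ℕ.^ f m) (Satisfiable φ))

-- P solves, in polynomial time, the satisfiability problem on the class 𝒞 of
-- formulas.  Nothing is required of P outside 𝒞.
SolvesInPolynomialTime : Program → (∀ n → CNF n → Set) → Set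
SolvesInPolynomialTime P 𝒞 = ∃ λ k →
  ∀ n (φ : CNF n) → 𝒞 n φ →
  Answers P (encode φ) (k ℕ.* (n ℕ.+ size φ) ℕ.^ k ℕ.+ k) (Satisfiable φ)

{-# OPTIONS --safe #-}
module Submission where

-- Adding w dummy variables to a formula φ in m variables multiplies its number
-- of satisfying assignments by 2 ^ w, and adding tautologies makes it
-- α-satisfiable for any fixed α < 1.  Hence, with n = m + w, the result obeys the
-- promise of SAT(n , 2 ^ (n - (log n) ^ (1 + c))) as soon as
-- m ≤ (log w) ^ (1 + c).  With g ≈ log m and u = ⌈ m / g ⌉, this is achieved by
-- w = 2 ^ O(u), because g ^ d = O(m) for all d.  A polynomial-time algorithm
-- then decides 3-SAT in time 2 ^ O(u + g) = 2 ^ o(m).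

-- The least padding would be about 2 ^ (m ^ (1 / (1 + c))), a root with a real exponent that the
-- program would have to compute. The quotient m / log m replaces it: it is o(m), yet eventually
-- exceeds m ^ (1 / (1 + c)) for every c > 0. So one construction serves all c, which enters only
-- through the constant in 2 ^ O(u). Indeed, if 1 / r ≤ c, it is enough that m ^ r ≤ (C u) ^ (r +
-- 1); as m ≤ u g, this follows from g ^ (r + 1) ≤ C m. The quotient is also easy to program: g
-- comes from repeated doubling and u from repeated subtraction, both on unary numerals.

open import Defs
import Algebra.Properties.CommutativeSemigroup as CommutativeSemigroup
open import Data.Bool.Base using (Bool; true; false; not; _∧_; _∨_)
import Data.Bool.Properties as Bool
open import Data.Fin.Base using (Fin; toℕ; _↑ˡ_; fromℕ<)
import Data.Fin.Properties as Fin
open import Data.Integer.Base as ℤ using (+_; -[1+_])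
import Data.Integer.Properties as ℤ
open import Data.List.Base
  using (List; []; _∷_; _++_; map; length; replicate; filterᵇ; allFin; cartesianProductWith)
open import Data.List.Membership.Propositional using (_∈_)
open import Data.List.Membership.Propositional.Properties
  using (∈-∃++; ∈-++⁻; ∈-++⁺ˡ; ∈-++⁺ʳ; ∈-map⁺; ∈-allFin; ∈-cartesianProductWith⁺)
import Data.List.Properties as List
open import Data.List.Relation.Unary.All as All using (All; []; _∷_)
open import Data.List.Relation.Unary.AllPairs using ([]; _∷_)
open import Data.List.Relation.Unary.Any using (here; there)
open import Data.List.Relation.Unary.Unique.Propositional using (Unique)
open import Data.Nat.Base
  using (ℕ; zero; suc; _+_; _*_; _∸_; _^_; _≤_; _<_; z≤n; s≤s; NonZero; ≢-nonZero⁻¹; >-nonZero; >-nonZero⁻¹)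
open import Data.Nat.DivMod as ℕ using (m/n*n≤m; m≡m%n+[m/n]*n; m%n<n)
open import Data.Nat.GeneralisedArithmetic using (iterate)
open import Data.Nat.Properties
open import Data.Product.Base using (∃; _×_; _,_; proj₁; proj₂)
open import Data.Rational.Base as ℚ using (ℚ; 0ℚ; 1ℚ; _/_; mkℚ; toℚᵘ)
import Data.Rational.Properties as ℚ
open import Data.Rational.Unnormalised.Base as ℚᵘ using (mkℚᵘ)
import Data.Rational.Unnormalised.Properties as ℚᵘ
open import Data.Sum.Base using (inj₁; inj₂)
open import Data.Vec.Base as Vec using (Vec)
import Data.Vec.Properties as Vec
open import Function.Base using (_∘_; id)
open import Function.Bundles using (_⇔_; mk⇔; module Equivalence)
open import Relation.Binary.Definitions using (tri<; tri≈; tri>)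
open import Relation.Binary.PropositionalEquality
open import Relation.Nullary using (¬_; yes; no; contradiction; Dec)
open import Relation.Unary using (Decidable)

open CommutativeSemigroup *-commutativeSemigroup using (interchange)

-- Executions up to pointwise equality of stores

⟦⟧-cong : ∀ e {σ τ} → σ ≗ τ → ⟦ e ⟧ σ ≡ ⟦ e ⟧ τ
⟦⟧-cong (var x)    σ≗τ = σ≗τ x
⟦⟧-cong nil        σ≗τ = refl
⟦⟧-cong (cons e f) σ≗τ = cong₂ _∙_ (⟦⟧-cong e σ≗τ) (⟦⟧-cong f σ≗τ)
⟦⟧-cong (hd e)     σ≗τ = cong head (⟦⟧-cong e σ≗τ)
⟦⟧-cong (tl e)     σ≗τ = cong tail (⟦⟧-cong e σ≗τ)

update-same : ∀ σ x {d} → (σ [ x ↦ d ]) x ≡ d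
update-same σ x with x ≟ x
... | yes _  = refl
... | no x≢x = contradiction refl x≢x

update-other : ∀ σ {x y d} → y ≢ x → (σ [ x ↦ d ]) y ≡ σ y
update-other σ {x} {y} y≢x with x ≟ y
... | yes x≡y = contradiction (sym x≡y) y≢x
... | no  _   = refl

update-cong : ∀ x {d e σ τ} → d ≡ e → σ ≗ τ → σ [ x ↦ d ] ≗ τ [ x ↦ e ]
update-cong x d≡e σ≗τ y with x ≟ y
... | yes _ = d≡e
... | no  _ = σ≗τ y

-- Stores are functions, so two descriptions of the same contents agree only pointwise; a run must
-- be transported along such an agreement before it can be chained to another.
⇓-cong : ∀ {P σ σ′ τ t} → σ ≗ σ′ → ⟨ P , σ ⟩⇓⟨ τ , t ⟩ → ∃ λ τ′ → ⟨ P , σ′ ⟩⇓⟨ τ′ , t ⟩ × τ ≗ τ′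
⇓-cong σ≗σ′ (assign {x} {e}) = _ , assign , update-cong x (⟦⟧-cong e σ≗σ′) σ≗σ′
⇓-cong σ≗σ′ (seq p q) with ⇓-cong σ≗σ′ p
... | _ , p′ , τ≗τ′ with ⇓-cong τ≗τ′ q
...   | _ , q′ , υ≗υ′ = _ , seq p′ q′ , υ≗υ′
⇓-cong σ≗σ′ (if-true {e} e≢nil p) with ⇓-cong σ≗σ′ p
... | _ , p′ , τ≗τ′ = _ , if-true (e≢nil ∘ trans (⟦⟧-cong e σ≗σ′)) p′ , τ≗τ′
⇓-cong σ≗σ′ (if-false {e} e≡nil p) with ⇓-cong σ≗σ′ p
... | _ , p′ , τ≗τ′ = _ , if-false (trans (sym (⟦⟧-cong e σ≗σ′)) e≡nil) p′ , τ≗τ′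
⇓-cong σ≗σ′ (while-true {e} e≢nil p q) with ⇓-cong σ≗σ′ p
... | _ , p′ , τ≗τ′ with ⇓-cong τ≗τ′ q
...   | _ , q′ , υ≗υ′ = _ , while-true (e≢nil ∘ trans (⟦⟧-cong e σ≗σ′)) p′ q′ , υ≗υ′
⇓-cong σ≗σ′ (while-false {e} e≡nil) = _ , while-false (trans (sym (⟦⟧-cong e σ≗σ′)) e≡nil) , σ≗σ′

Runs : Program → Store → Store → ℕ → Set
Runs P σ τ T = ∃ λ τ′ → ∃ λ t → ⟨ P , σ ⟩⇓⟨ τ′ , t ⟩ × t ≤ T × τ′ ≗ τ

runs-weaken : ∀ {P σ τ τ′ T T′} → T ≤ T′ → τ ≗ τ′ → Runs P σ τ T → Runs P σ τ′ T′
runs-weaken T≤T′ τ≗τ′ (_ , _ , p , t≤T , eq) = _ , _ , p , ≤-trans t≤T T≤T′ , λ x → trans (eq x) (τ≗τ′ x)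

runs-assign : ∀ x e {σ τ} → σ [ x ↦ ⟦ e ⟧ σ ] ≗ τ → Runs (x ≔ e) σ τ (suc (cost e))
runs-assign x e eq = _ , _ , assign , ≤-refl , eq

infixr 20 _⨟_

_⨟_ : ∀ {P Q σ τ υ S T} → Runs P σ τ S → Runs Q τ υ T → Runs (P ⨾ Q) σ υ (S + T)
(_ , _ , p , s≤S , τ≗) ⨟ (_ , _ , q , t≤T , υ≗) with ⇓-cong (sym ∘ τ≗) q
... | _ , q′ , υ′≗ = _ , _ , seq p q′ , +-mono-≤ s≤S t≤T , λ x → trans (sym (υ′≗ x)) (υ≗ x)

runs-while-true : ∀ {e P σ τ υ S T} → ⟦ e ⟧ σ ≢ nil →
  Runs P σ τ S → Runs (while e loop P) τ υ T →
  Runs (while e loop P) σ υ (suc (cost e) + (S + T))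
runs-while-true {e} e≢nil (_ , _ , p , s≤S , τ≗) (_ , _ , q , t≤T , υ≗) with ⇓-cong (sym ∘ τ≗) q
... | _ , q′ , υ′≗ = _ , _ , while-true e≢nil p q′
                   , +-monoʳ-≤ (suc (cost e)) (+-mono-≤ s≤S t≤T) , λ x → trans (sym (υ′≗ x)) (υ≗ x)

runs-while-false : ∀ {e P σ τ} → ⟦ e ⟧ σ ≡ nil → σ ≗ τ → Runs (while e loop P) σ τ (suc (cost e))
runs-while-false e≡nil eq = _ , _ , while-false e≡nil , ≤-refl , eq

runs-while : ∀ {e P} (σ : ℕ → Store) k {T} →
  (∀ i → i < k → ⟦ e ⟧ (σ i) ≢ nil) → (∀ i → i < k → Runs P (σ i) (σ (suc i)) T) →
  ⟦ e ⟧ (σ k) ≡ nil →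
  Runs (while e loop P) (σ 0) (σ k) (k * (suc (cost e) + T) + suc (cost e))
runs-while σ zero    guard body end = runs-while-false end λ _ → refl
runs-while {e} σ (suc k) {T} guard body end = runs-weaken (≤-reflexive eq) (λ _ → refl)
  (runs-while-true (guard 0 (s≤s z≤n)) (body 0 (s≤s z≤n))
    (runs-while (σ ∘ suc) k (λ i → guard (suc i) ∘ s≤s) (λ i → body (suc i) ∘ s≤s) end))
  where
  c = suc (cost e)
  eq : c + (T + (k * (c + T) + c)) ≡ c + T + k * (c + T) + c
  eq = trans (sym (+-assoc c T _)) (sym (+-assoc (c + T) _ c))

-- Counting loops and unary arithmetic

forEach : ℕ → Expr → ℕ → Expr → Program
forEach z e x f = z ≔ e ⨾ while var z loop (x ≔ f ⨾ z ≔ tl (var z))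

-- In each round, 2 pays for the guard and 3 for shortening `z`; the last 2 is the failing guard.
forEachCost : Expr → Expr → ℕ → ℕ
forEachCost e f n = suc (cost e) + (n * (2 + (suc (cost f) + 3)) + 2)

-- Since `e` is copied into `z` before the loop, it may mention `x`: a register can be doubled by
-- stepping through its own old value. Only the length of the list matters, so the same loop counts
-- through numerals and through the clauses of a formula.
runs-forEach : ∀ z e x f (h : D → D) {σ} ds → x ≢ z → (∀ τ → ⟦ f ⟧ τ ≡ h (τ x)) →
  ⟦ e ⟧ σ ≡ encodeList ds →
  Runs (forEach z e x f) σ ((σ [ x ↦ iterate h (σ x) (length ds) ]) [ z ↦ nil ])
    (forEachCost e f (length ds))
runs-forEach z e x f h {σ} ds x≢z f≗h e≡ds = runs-weaken ≤-refl eq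
  (runs-assign z e (update-cong z e≡ds λ _ → refl) ⨟ steps ds (update-same σ z))
  where
  steps : ∀ ds {σ} → σ z ≡ encodeList ds → Runs (while var z loop (x ≔ f ⨾ z ≔ tl (var z))) σ
    ((σ [ x ↦ iterate h (σ x) (length ds) ]) [ z ↦ nil ])
    (length ds * (2 + (suc (cost f) + 3)) + 2)
  steps [] {σ} σz≡nil = runs-while-false σz≡nil σ≗
    where
    σ≗ : σ ≗ (σ [ x ↦ σ x ]) [ z ↦ nil ]
    σ≗ y with z ≟ y
    ... | yes refl = σz≡nil
    ... | no  _ with x ≟ y
    ...   | yes refl = refl
    ...   | no  _    = refl
  steps (d ∷ ds) {σ} σz≡ = runs-weaken (≤-reflexive cost≡) τ≗
    (runs-while-true (λ σz≡nil → contradiction (trans (sym σz≡) σz≡nil) λ ())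
      (runs-assign x f (λ _ → refl) ⨟ runs-assign z (tl (var z)) (λ _ → refl))
      (steps ds (trans (update-same (σ [ x ↦ _ ]) z)
        (cong tail (trans (update-other σ (x≢z ∘ sym)) σz≡)))))
    where
    c = suc (cost f) + 3
    cost≡ : 2 + (c + (length ds * (2 + c) + 2)) ≡ 2 + c + length ds * (2 + c) + 2
    cost≡ = cong (λ n → 2 + n) (sym (+-assoc c _ 2))
    σ′ = (σ [ x ↦ ⟦ f ⟧ σ ]) [ z ↦ tail ((σ [ x ↦ ⟦ f ⟧ σ ]) z) ]
    σ′x : σ′ x ≡ h (σ x)
    σ′x = trans (update-other (σ [ x ↦ _ ]) x≢z) (trans (update-same σ x) (f≗h σ))
    τ≗ : (σ′ [ x ↦ iterate h (σ′ x) (length ds) ]) [ z ↦ nil ] ≗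
         (σ [ x ↦ iterate h (h (σ x)) (length ds) ]) [ z ↦ nil ]
    τ≗ y with z ≟ y in eq
    ... | yes _ = refl
    ... | no  z≢y with x ≟ y in eq′
    ...   | yes _   = cong (λ d → iterate h d (length ds)) σ′x
    ...   | no  _ rewrite eq | eq′ = refl

  eq : ((σ [ z ↦ encodeList ds ]) [ x ↦ iterate h ((σ [ z ↦ encodeList ds ]) x) (length ds) ]) [ z ↦ nil ]
       ≗ (σ [ x ↦ iterate h (σ x) (length ds) ]) [ z ↦ nil ]
  eq y with z ≟ y in eq
  ... | yes _ = refl
  ... | no  _ with x ≟ y
  ...   | yes _ = cong (λ d → iterate h d (length ds)) (update-other σ x≢z)
  ...   | no  _ rewrite eq = refl

-- `k` is a constant of the program, so the copies are unrolled into one expression. Prepending `k`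
-- nils to a numeral `w`, once for each of its units, turns it into `w * suc k`.
prependExpr : ℕ → Expr → Expr → Expr
prependExpr zero    a e = e
prependExpr (suc k) a e = cons a (prependExpr k a e)

prepend : ℕ → D → D → D
prepend zero    a d = d
prepend (suc k) a d = a ∙ prepend k a d

⟦prependExpr⟧ : ∀ k {a a′} e {σ} → ⟦ a ⟧ σ ≡ a′ → ⟦ prependExpr k a e ⟧ σ ≡ prepend k a′ (⟦ e ⟧ σ)
⟦prependExpr⟧ zero    e eq = refl
⟦prependExpr⟧ (suc k) e eq = cong₂ _∙_ eq (⟦prependExpr⟧ k e eq)

iterate-tail : ∀ j m → iterate tail (encodeℕ m) j ≡ encodeℕ (m ∸ j)
iterate-tail zero    m       = refl
iterate-tail (suc j) zero    = trans (iterate-tail j 0) (cong encodeℕ (0∸n≡0 j))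
iterate-tail (suc j) (suc m) = iterate-tail j m

prepend-encodeList : ∀ k d ds → prepend k d (encodeList ds) ≡ encodeList (replicate k d ++ ds)
prepend-encodeList zero    d ds = refl
prepend-encodeList (suc k) d ds = cong (d ∙_) (prepend-encodeList k d ds)

replicate-+ : ∀ {A : Set} m n {x : A} → replicate m x ++ replicate n x ≡ replicate (m + n) x
replicate-+ zero    n = refl
replicate-+ (suc m) n = cong (_ ∷_) (replicate-+ m n)

iterate-prepend : ∀ j k d ds →
  iterate (prepend k d) (encodeList ds) j ≡ encodeList (replicate (j * k) d ++ ds)
iterate-prepend zero    k d ds = refl
iterate-prepend (suc j) k d ds = begin
  iterate (prepend k d) (prepend k d (encodeList ds)) j
    ≡⟨ cong (λ e → iterate (prepend k d) e j) (prepend-encodeList k d ds) ⟩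
  iterate (prepend k d) (encodeList (replicate k d ++ ds)) j
    ≡⟨ iterate-prepend j k d _ ⟩
  encodeList (replicate (j * k) d ++ replicate k d ++ ds)
    ≡⟨ cong encodeList (sym (List.++-assoc (replicate (j * k) d) _ ds)) ⟩
  encodeList ((replicate (j * k) d ++ replicate k d) ++ ds)
    ≡⟨ cong (λ l → encodeList (l ++ ds)) (replicate-+ (j * k) k) ⟩
  encodeList (replicate (j * k + k) d ++ ds)
    ≡⟨ cong (λ n → encodeList (replicate n d ++ ds)) (+-comm (j * k) k) ⟩
  encodeList (replicate (k + j * k) d ++ ds) ∎
  where open ≡-Reasoning

iterate-prepend-nil : ∀ j k m → iterate (prepend k nil) (encodeℕ m) j ≡ encodeℕ (j * k + m)
iterate-prepend-nil j k m =
  trans (iterate-prepend j k nil (replicate m nil)) (cong encodeList (replicate-+ (j * k) m))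

-- The preprocessing program

least : ∀ {P : ℕ → Set} → (∀ n → Dec (P n)) → ∀ n → P n → ∃ λ k → P k × (∀ i → i < k → ¬ P i)
least P? zero Pn = 0 , Pn , λ _ ()
least P? (suc n) Pn with P? 0
... | yes P0 = 0 , P0 , λ _ ()
... | no ¬P0 with least (P? ∘ suc) n Pn
...   | k , Pk , ¬P = suc k , Pk , λ { zero _ → ¬P0 ; (suc i) (s≤s i<k) → ¬P i i<k }

n<2^n : ∀ n → n < 2 ^ n
n<2^n zero    = s≤s z≤n
n<2^n (suc n) = begin-strict
  suc n           <⟨ +-mono-≤-< (>-nonZero⁻¹ (2 ^ n) {{m^n≢0 2 n}}) (n<2^n n) ⟩
  2 ^ n + 2 ^ n   ≡⟨ cong (λ x → 2 ^ n + x) (sym (+-identityʳ (2 ^ n))) ⟩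
  2 ^ suc n       ∎
  where open ≤-Reasoning

leastPower : ∀ m → ∃ λ G → m < 2 ^ G × (∀ i → i < G → ¬ (m < 2 ^ i))
leastPower m = least (λ i → m <? 2 ^ i) m (n<2^n m)

bitLength : ℕ → ℕ
bitLength = proj₁ ∘ leastPower

bitLength-upper : ∀ m → m < 2 ^ bitLength m
bitLength-upper = proj₁ ∘ proj₂ ∘ leastPower

bitLength-lower : ∀ m i → i < bitLength m → 2 ^ i ≤ m
bitLength-lower m i i< = ≮⇒≥ (proj₂ (proj₂ (leastPower m)) i i<)

-- The successor keeps the stride positive even at `m = 0`, so that `m` itself is a valid start for
-- the search in `leastMultiple`.
stride : ℕ → ℕ
stride m = suc (bitLength m)

-- The quotient ⌈ m / stride m ⌉, as a least index rather than by division: its two properties say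
-- that the guard of `growLoop` fails after the last round and holds before it.
leastMultiple : ∀ m → ∃ λ u → m ≤ u * stride m × (∀ i → i < u → ¬ (m ≤ i * stride m))
leastMultiple m = least (λ i → m ≤? i * stride m) m (m≤m*n m (stride m))

rounds : ℕ → ℕ
rounds = proj₁ ∘ leastMultiple

rounds-upper : ∀ m → m ≤ rounds m * stride m
rounds-upper = proj₁ ∘ proj₂ ∘ leastMultiple

rounds-lower : ∀ m i → i < rounds m → i * stride m < m
rounds-lower m i i< = ≰⇒> (proj₂ (proj₂ (leastMultiple m)) i i<)

registers : D → D → D → D → D → Store
registers a b c d e 0 = a
registers a b c d e 1 = b
registers a b c d e 2 = c
registers a b c d e 3 = d
registers a b c d e 4 = e
registers a b c d e _ = nil

≗-registers : ∀ {σ a b c d e} → σ 0 ≡ a → σ 1 ≡ b → σ 2 ≡ c → σ 3 ≡ d → σ 4 ≡ e →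
  (∀ n → σ (5 + n) ≡ nil) → σ ≗ registers a b c d e
≗-registers p₀ p₁ p₂ p₃ p₄ p 0 = p₀
≗-registers p₀ p₁ p₂ p₃ p₄ p 1 = p₁
≗-registers p₀ p₁ p₂ p₃ p₄ p 2 = p₂
≗-registers p₀ p₁ p₂ p₃ p₄ p 3 = p₃
≗-registers p₀ p₁ p₂ p₃ p₄ p 4 = p₄
≗-registers p₀ p₁ p₂ p₃ p₄ p (suc (suc (suc (suc (suc n))))) = p n

encodeℕ≢nil : ∀ {n} → 0 < n → encodeℕ n ≢ nil
encodeℕ≢nil {suc n} _ ()

runs-forEachℕ : ∀ z e x f (h : D → D) n {σ d} → x ≢ z → (∀ τ → ⟦ f ⟧ τ ≡ h (τ x)) →
  ⟦ e ⟧ σ ≡ encodeℕ n → iterate h (σ x) n ≡ d →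
  Runs (forEach z e x f) σ ((σ [ x ↦ d ]) [ z ↦ nil ]) (forEachCost e f n)
runs-forEachℕ z e x f h n {σ} {d} x≢z f≗h e≡n eq =
  subst (λ l → iterate h (σ x) l ≡ d → Runs (forEach z e x f) σ ((σ [ x ↦ d ]) [ z ↦ nil ]) (forEachCost e f l))
    (List.length-replicate n)
    (λ eq → runs-weaken ≤-refl (update-cong z refl (update-cong x {σ = σ} eq λ _ → refl))
      (runs-forEach z e x f h (replicate n D.nil) x≢z f≗h e≡n))
    eq

logLoop : Program
logLoop = while var 1 loop
  (forEach 4 (var 2) 1 (tl (var 1)) ⨾ forEach 4 (var 2) 2 (cons nil (var 2)) ⨾ 3 ≔ cons nil (var 3))

logLoopCost : ℕ → ℕ
logLoopCost m = bitLength m *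
  (2 + (forEachCost (var 2) (tl (var 1)) m + (forEachCost (var 2) (cons nil (var 2)) m + 4))) + 2

forEachCost-mono : ∀ e f {m n} → m ≤ n → forEachCost e f m ≤ forEachCost e f n
forEachCost-mono e f m≤n = +-monoʳ-≤ (suc (cost e)) (+-monoˡ-≤ 2 (*-monoˡ-≤ _ m≤n))

-- Subtracting 1, 2, 4, … leaves m ∸ (2 ^ i ∸ 1) after i rounds, which
-- vanishes as soon as m < 2 ^ i.
runs-logLoop : ∀ d m → Runs logLoop (registers d (encodeℕ m) (encodeℕ 1) (encodeℕ 1) nil)
  (registers d nil (encodeℕ (2 ^ bitLength m)) (encodeℕ (stride m)) nil) (logLoopCost m)
runs-logLoop d m = runs-weaken ≤-refl
  (≗-registers refl (cong encodeℕ end) refl refl refl λ _ → refl)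
  (runs-while σ (bitLength m)
    (λ i i< → encodeℕ≢nil (m<n⇒0<n∸m (s≤s (bitLength-lower m i i<))))
    (λ i i< → runs-weaken
        (+-mono-≤ (forEachCost-mono (var 2) (tl (var 1)) (bitLength-lower m i i<))
          (+-monoˡ-≤ 4 (forEachCost-mono (var 2) (cons nil (var 2)) (bitLength-lower m i i<))))
        (≗-registers refl (cong encodeℕ (trans (∸-+-assoc (suc m) (2 ^ i) (2 ^ i)) (cong (suc m ∸_) (double i))))
          (cong encodeℕ (trans (cong (_+ 2 ^ i) (*-identityʳ (2 ^ i))) (double i))) refl refl λ _ → refl)
        (runs-forEachℕ 4 (var 2) 1 (tl (var 1)) tail (2 ^ i) (λ ()) (λ _ → refl) refl
            (iterate-tail (2 ^ i) (suc m ∸ 2 ^ i))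
          ⨟ runs-forEachℕ 4 (var 2) 2 (cons nil (var 2)) (prepend 1 nil) (2 ^ i) (λ ()) (λ _ → refl) refl
            (iterate-prepend-nil (2 ^ i) 1 (2 ^ i))
          ⨟ runs-assign 3 (cons nil (var 3)) λ _ → refl))
    (cong encodeℕ end))
  where
  σ : ℕ → Store
  σ i = registers d (encodeℕ (suc m ∸ 2 ^ i)) (encodeℕ (2 ^ i)) (encodeℕ (suc i)) nil
  end : suc m ∸ 2 ^ bitLength m ≡ 0
  end = m≤n⇒m∸n≡0 (bitLength-upper m)
  double : ∀ i → 2 ^ i + 2 ^ i ≡ 2 ^ suc i
  double i = cong (λ x → 2 ^ i + x) (sym (+-identityʳ (2 ^ i)))

-- Division and exponentiation in one loop: each `stride m` taken off register 1 multiplies register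
-- 2 by `suc k`.
growLoop : ℕ → Program
growLoop k = while var 1 loop
  (forEach 4 (var 3) 1 (tl (var 1)) ⨾ forEach 4 (var 2) 2 (prependExpr k nil (var 2)))

-- Every round is charged as if register 2 already had its final value; the loss is at most
-- polynomial in that value.
growLoopCost : ℕ → ℕ → ℕ
growLoopCost k m = rounds m *
  (2 + (forEachCost (var 3) (tl (var 1)) (stride m) +
        forEachCost (var 2) (prependExpr k nil (var 2)) (suc k ^ rounds m))) + 2

runs-growLoop : ∀ k d m → Runs (growLoop k) (registers d (encodeℕ m) (encodeℕ 1) (encodeℕ (stride m)) nil)
  (registers d nil (encodeℕ (suc k ^ rounds m)) (encodeℕ (stride m)) nil) (growLoopCost k m)
runs-growLoop k d m = runs-weaken ≤-refl
  (≗-registers refl (cong encodeℕ end) refl refl refl λ _ → refl)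
  (runs-while σ (rounds m)
    (λ i i< → encodeℕ≢nil (m<n⇒0<n∸m (rounds-lower m i i<)))
    (λ i i< → runs-weaken
        (+-monoʳ-≤ (forEachCost (var 3) (tl (var 1)) (stride m)) (forEachCost-mono (var 2) f (^-monoʳ-≤ (suc k) (<⇒≤ i<))))
        (≗-registers refl
          (cong encodeℕ (trans (∸-+-assoc m (i * stride m) (stride m)) (cong (m ∸_) (+-comm (i * stride m) (stride m)))))
          (cong encodeℕ (trans (+-comm (suc k ^ i * k) _) (cong (λ x → suc k ^ i + x) (*-comm (suc k ^ i) k))))
          refl refl λ _ → refl)
        (runs-forEachℕ 4 (var 3) 1 (tl (var 1)) tail (stride m) (λ ()) (λ _ → refl) refl
            (iterate-tail (stride m) (m ∸ i * stride m))
          ⨟ runs-forEachℕ 4 (var 2) 2 f (prepend k nil) (suc k ^ i) (λ ())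
            (λ _ → ⟦prependExpr⟧ k (var 2) refl) refl
            (iterate-prepend-nil (suc k ^ i) k (suc k ^ i))))
    (cong encodeℕ end))
  where
  f = prependExpr k nil (var 2)
  σ : ℕ → Store
  σ i = registers d (encodeℕ (m ∸ i * stride m)) (encodeℕ (suc k ^ i)) (encodeℕ (stride m)) nil
  end : m ∸ rounds m * stride m ≡ 0
  end = m≤n⇒m∸n≡0 (rounds-upper m)

-- The code of x₀ ∨ ¬ x₀. The index 0 is coded by `nil`, so this tree does not depend on the number
-- of variables and can be written into the program.
tautologyExpr : Expr
tautologyExpr = cons (cons (cons nil nil) nil) (cons (cons nil nil) nil)

tautologyD : D
tautologyD = ((nil ∙ nil) ∙ nil) ∙ ((nil ∙ nil) ∙ nil)

preprocess : ℕ → ℕ → Program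
preprocess k t =
  1 ≔ hd (var 0) ⨾ 2 ≔ cons nil nil ⨾ 3 ≔ cons nil nil ⨾ logLoop ⨾
  1 ≔ hd (var 0) ⨾ 2 ≔ cons nil nil ⨾ growLoop k ⨾
  forEach 4 (hd (var 0)) 2 (cons nil (var 2)) ⨾ 3 ≔ tl (var 0) ⨾
  forEach 4 (var 3) 3 (prependExpr t tautologyExpr (var 3)) ⨾
  -- The algorithm that runs next expects `nil` in every register but 0; `forEach` has already
  -- cleared register 4.
  0 ≔ cons (var 2) (var 3) ⨾ 1 ≔ nil ⨾ 2 ≔ nil ⨾ 3 ≔ nil

preprocessCost : ℕ → ℕ → ℕ → ℕ → ℕ
preprocessCost k t m l =
  3 + (4 + (4 + (logLoopCost m +
  (3 + (4 + (growLoopCost k m +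
  (forEachCost (hd (var 0)) (cons nil (var 2)) m + (3 +
  (forEachCost (var 3) (prependExpr t tautologyExpr (var 3)) l +
  (4 + (2 + (2 + 2))))))))))))

runs-preprocess : ∀ k t m ds → Runs (preprocess k t) (initial (encodeℕ m ∙ encodeList ds))
  (initial (encodeℕ (m + suc k ^ rounds m) ∙ encodeList (replicate (length ds * t) tautologyD ++ ds)))
  (preprocessCost k t m (length ds))
runs-preprocess k t m ds = runs-weaken ≤-refl final
  ( runs-assign 1 (hd (var 0)) (λ _ → refl)
  ⨟ runs-assign 2 (cons nil nil) (λ _ → refl)
  ⨟ runs-assign 3 (cons nil nil) (≗-registers refl refl refl refl refl λ _ → refl)
  ⨟ runs-logLoop d m
  ⨟ runs-assign 1 (hd (var 0)) (λ _ → refl)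
  ⨟ runs-assign 2 (cons nil nil) (≗-registers refl refl refl refl refl λ _ → refl)
  ⨟ runs-growLoop k d m
  ⨟ runs-forEachℕ 4 (hd (var 0)) 2 (cons nil (var 2)) (prepend 1 nil) m (λ ()) (λ _ → refl) refl
      (iterate-prepend-nil m 1 (suc k ^ rounds m))
  ⨟ runs-assign 3 (tl (var 0)) (λ _ → refl)
  ⨟ runs-forEach 4 (var 3) 3 (prependExpr t tautologyExpr (var 3)) (prepend t tautologyD) ds (λ ())
      (λ _ → ⟦prependExpr⟧ t (var 3) refl) refl
  ⨟ runs-assign 0 (cons (var 2) (var 3)) (λ _ → refl)
  ⨟ runs-assign 1 nil (λ _ → refl)
  ⨟ runs-assign 2 nil (λ _ → refl)
  ⨟ runs-assign 3 nil (≗-registers refl refl refl refl refl λ _ → refl))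
  where
  d = encodeℕ m ∙ encodeList ds
  final : registers _ nil nil nil nil ≗ _
  final 0 = cong₂ _∙_ (cong (λ j → encodeℕ (j + suc k ^ rounds m)) (*-identityʳ m))
    (iterate-prepend (length ds) t tautologyD ds)
  final 1 = refl
  final 2 = refl
  final 3 = refl
  final 4 = refl
  final (suc (suc (suc (suc (suc _))))) = refl

-- The padded formula

∃-Vec? : ∀ n {P : Assignment n → Set} → Decidable P → Dec (∃ P)
∃-Vec? zero P? with P? Vec.[]
... | yes p = yes (_ , p)
... | no ¬p = no λ { (Vec.[] , p) → ¬p p }
∃-Vec? (suc n) P? with ∃-Vec? n (P? ∘ (true Vec.∷_)) | ∃-Vec? n (P? ∘ (false Vec.∷_))
... | yes (_ , p) | _           = yes (_ , p)
... | no  _       | yes (_ , p) = yes (_ , p)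
... | no ¬t       | no ¬f       = no λ { (true Vec.∷ v , p) → ¬t (v , p) ; (false Vec.∷ v , p) → ¬f (v , p) }

-- The promise is a disjoint sum, so a constructive proof of it has to decide which side holds. This
-- search belongs to the proof, not to the program.
satisfiable? : ∀ {n} (φ : CNF n) → Dec (Satisfiable φ)
satisfiable? {n} φ = ∃-Vec? n λ v → evalCNF v φ Bool.≟ true

length-filterᵇ-++ : ∀ {A : Set} (p : A → Bool) xs ys →
  length (filterᵇ p (xs ++ ys)) ≡ length (filterᵇ p xs) + length (filterᵇ p ys)
length-filterᵇ-++ p xs ys =
  trans (cong length (List.filter-++ (Bool.T? ∘ p) xs ys)) (List.length-++ (filterᵇ p xs))

length-filterᵇ-map : ∀ {A B : Set} (p : B → Bool) (f : A → B) xs →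
  length (filterᵇ p (map f xs)) ≡ length (filterᵇ (p ∘ f) xs)
length-filterᵇ-map p f []       = refl
length-filterᵇ-map p f (x ∷ xs) with p (f x)
... | true  = cong suc (length-filterᵇ-map p f xs)
... | false = length-filterᵇ-map p f xs

length-filterᵇ-replicate : ∀ {A : Set} (p : A → Bool) n {x} → p x ≡ true → length (filterᵇ p (replicate n x)) ≡ n
length-filterᵇ-replicate p zero    px = refl
length-filterᵇ-replicate p (suc n) {x} px rewrite px = cong suc (length-filterᵇ-replicate p n px)

length-filterᵇ-all : ∀ {A : Set} (p : A → Bool) xs → (∀ x → p x ≡ true) → length (filterᵇ p xs) ≡ length xs
length-filterᵇ-all p []       all-p = refl
length-filterᵇ-all p (x ∷ xs) all-p rewrite all-p x = cong suc (length-filterᵇ-all p xs all-p)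

length-assignments : ∀ n → length (assignments n) ≡ 2 ^ n
length-assignments zero    = refl
length-assignments (suc n) = begin
  length (map (true Vec.∷_) (assignments n) ++ map (false Vec.∷_) (assignments n))
    ≡⟨ List.length-++ (map (true Vec.∷_) (assignments n)) ⟩
  length (map (true Vec.∷_) (assignments n)) + length (map (false Vec.∷_) (assignments n))
    ≡⟨ cong₂ _+_ (half true) (trans (half false) (sym (+-identityʳ _))) ⟩
  2 ^ suc n ∎
  where
  open ≡-Reasoning
  half : ∀ b → length (map (b Vec.∷_) (assignments n)) ≡ 2 ^ n
  half b = trans (List.length-map _ (assignments n)) (length-assignments n)

-- Each bit of `v` selects one half of the list of assignments; after all of them, the `2 ^ w`
-- extensions of `v` remain.
count-extensions : ∀ {m} w (v : Vec Bool m) (p : Assignment (m + w) → Bool) →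
  (∀ v′ → p (v Vec.++ v′) ≡ true) → 2 ^ w ≤ length (filterᵇ p (assignments (m + w)))
count-extensions w Vec.[] p all-p =
  ≤-reflexive (sym (trans (length-filterᵇ-all p (assignments w) all-p) (length-assignments w)))
count-extensions {suc m} w (b Vec.∷ v) p all-p = begin
  2 ^ w
    ≤⟨ count-extensions w v (p ∘ (b Vec.∷_)) all-p ⟩
  length (filterᵇ (p ∘ (b Vec.∷_)) vs)
    ≡⟨ length-filterᵇ-map p (b Vec.∷_) vs ⟨
  length (filterᵇ p (map (b Vec.∷_) vs))
    ≤⟨ branch b ⟩
  length (filterᵇ p (map (true Vec.∷_) vs)) + length (filterᵇ p (map (false Vec.∷_) vs))
    ≡⟨ length-filterᵇ-++ p (map (true Vec.∷_) vs) _ ⟨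
  length (filterᵇ p (assignments (suc m + w))) ∎
  where
  open ≤-Reasoning
  vs = assignments (m + w)
  branch : ∀ b → length (filterᵇ p (map (b Vec.∷_) vs)) ≤
    length (filterᵇ p (map (true Vec.∷_) vs)) + length (filterᵇ p (map (false Vec.∷_) vs))
  branch true  = m≤m+n _ _
  branch false = m≤n+m _ _

weakenLiteral : ∀ {m} w → Literal m → Literal (m + w)
weakenLiteral w (pos i) = pos (i ↑ˡ w)
weakenLiteral w (neg i) = neg (i ↑ˡ w)

weaken : ∀ {m} w → CNF m → CNF (m + w)
weaken w = map (map (weakenLiteral w))

evalLiteral-weaken : ∀ {m w} (v : Vec Bool m) (v′ : Vec Bool w) l →
  evalLiteral (v Vec.++ v′) (weakenLiteral w l) ≡ evalLiteral v l
evalLiteral-weaken v v′ (pos i) = Vec.lookup-++ˡ v v′ i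
evalLiteral-weaken v v′ (neg i) = cong not (Vec.lookup-++ˡ v v′ i)

evalClause-weaken : ∀ {m w} (v : Vec Bool m) (v′ : Vec Bool w) C →
  evalClause (v Vec.++ v′) (map (weakenLiteral w) C) ≡ evalClause v C
evalClause-weaken v v′ []      = refl
evalClause-weaken v v′ (l ∷ C) = cong₂ _∨_ (evalLiteral-weaken v v′ l) (evalClause-weaken v v′ C)

evalCNF-weaken : ∀ {m w} (v : Vec Bool m) (v′ : Vec Bool w) φ →
  evalCNF (v Vec.++ v′) (weaken w φ) ≡ evalCNF v φ
evalCNF-weaken v v′ []      = refl
evalCNF-weaken v v′ (C ∷ φ) = cong₂ _∧_ (evalClause-weaken v v′ C) (evalCNF-weaken v v′ φ)

-- Literals are coded by the value of their index, which `↑ˡ` preserves. Hence the program copies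
-- the old clauses verbatim and changes only the number of variables.
encode-weaken : ∀ {m} w (φ : CNF m) → map encodeClause (weaken w φ) ≡ map encodeClause φ
encode-weaken w φ = trans (sym (List.map-∘ φ)) (List.map-cong clause φ)
  where
  literal : ∀ l → encodeLiteral (weakenLiteral w l) ≡ encodeLiteral l
  literal (pos i) = cong (λ n → (nil ∙ nil) ∙ encodeℕ n) (Fin.toℕ-↑ˡ i w)
  literal (neg i) = cong (λ n → nil ∙ encodeℕ n) (Fin.toℕ-↑ˡ i w)
  clause : ∀ C → encodeClause (map (weakenLiteral w) C) ≡ encodeClause C
  clause C = cong encodeList (trans (sym (List.map-∘ C)) (List.map-cong literal C))

size-weaken : ∀ {m} w (φ : CNF m) → size (weaken w φ) ≡ size φ
size-weaken w []      = refl
size-weaken w (C ∷ φ) = cong₂ (λ a b → suc a + b) (List.length-map _ C) (size-weaken w φ)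

tautology : ∀ {n} → Fin n → Clause n
tautology i = pos i ∷ neg i ∷ []

evalClause-tautology : ∀ {n} (v : Assignment n) i → evalClause v (tautology i) ≡ true
evalClause-tautology v i with Vec.lookup v i
... | true  = refl
... | false = refl

padded : ∀ {m} w → Fin (m + w) → ℕ → CNF m → CNF (m + w)
padded w i t φ = replicate (length φ * t) (tautology i) ++ weaken w φ

evalCNF-padded : ∀ {m} w i t (φ : CNF m) (v : Vec Bool m) (v′ : Vec Bool w) →
  evalCNF (v Vec.++ v′) (padded w i t φ) ≡ evalCNF v φ
evalCNF-padded w i t φ v v′ = go (length φ * t)
  where
  go : ∀ n → evalCNF (v Vec.++ v′) (replicate n (tautology i) ++ weaken w φ) ≡ evalCNF v φ
  go zero    = evalCNF-weaken v v′ φ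
  go (suc n) = cong₂ _∧_ (evalClause-tautology (v Vec.++ v′) i) (go n)

satisfiable-padded : ∀ {m} w i t (φ : CNF m) → Satisfiable (padded w i t φ) ⇔ Satisfiable φ
satisfiable-padded {m} w i t φ = mk⇔ to
  (λ (v , vφ) → v Vec.++ Vec.replicate w true , trans (evalCNF-padded w i t φ v _) vφ)
  where
  to : Satisfiable (padded w i t φ) → Satisfiable φ
  to (v , vψ) with Vec.splitAt m v
  ... | v₁ , v₂ , refl = v₁ , trans (sym (evalCNF-padded w i t φ v₁ v₂)) vψ

#sat-padded : ∀ {m} w i t (φ : CNF m) → Satisfiable φ → 2 ^ w ≤ #sat (padded w i t φ)
#sat-padded w i t φ (v , vφ) = count-extensions w v _ λ v′ → trans (evalCNF-padded w i t φ v v′) vφ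

length-padded : ∀ {m} w i t (φ : CNF m) → length (padded w i t φ) ≡ length φ * suc t
length-padded w i t φ = begin
  length (replicate (length φ * t) (tautology i) ++ weaken w φ)
    ≡⟨ List.length-++ (replicate (length φ * t) (tautology i)) ⟩
  length (replicate (length φ * t) (tautology i)) + length (weaken w φ)
    ≡⟨ cong₂ _+_ (List.length-replicate (length φ * t)) (List.length-map _ φ) ⟩
  length φ * t + length φ
    ≡⟨ +-comm (length φ * t) (length φ) ⟩
  length φ + length φ * t
    ≡⟨ *-suc (length φ) t ⟨
  length φ * suc t ∎
  where open ≡-Reasoning

#satisfiedClauses-padded : ∀ {m} w i t (φ : CNF m) v → length φ * t ≤ #satisfiedClauses v (padded w i t φ)
#satisfiedClauses-padded w i t φ v = begin
  length φ * t
    ≡⟨ length-filterᵇ-replicate (evalClause v) (length φ * t) (evalClause-tautology v i) ⟨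
  length (filterᵇ (evalClause v) (replicate (length φ * t) (tautology i)))
    ≤⟨ m≤m+n _ _ ⟩
  length (filterᵇ (evalClause v) (replicate (length φ * t) (tautology i))) +
  length (filterᵇ (evalClause v) (weaken w φ))
    ≡⟨ length-filterᵇ-++ (evalClause v) (replicate (length φ * t) (tautology i)) _ ⟨
  #satisfiedClauses v (padded w i t φ) ∎
  where open ≤-Reasoning

size-padded : ∀ {m} w i t (φ : CNF m) → size (padded w i t φ) ≡ length φ * t * 3 + size φ
size-padded w i t φ = go (length φ * t)
  where
  go : ∀ n → size (replicate n (tautology i) ++ weaken w φ) ≡ n * 3 + size φ
  go zero    = size-weaken w φ
  go (suc n) = cong (λ k → 3 + k) (go n)

encode-padded : ∀ {m} w i t (φ : CNF m) → toℕ i ≡ 0 →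
  encode (padded w i t φ) ≡
  encodeℕ (m + w) ∙ encodeList (replicate (length φ * t) tautologyD ++ map encodeClause φ)
encode-padded {m} w i t φ i≡0 = cong (λ l → encodeℕ (m + w) ∙ encodeList l) (begin
  map encodeClause (replicate (length φ * t) (tautology i) ++ weaken w φ)
    ≡⟨ List.map-++ encodeClause (replicate (length φ * t) (tautology i)) _ ⟩
  map encodeClause (replicate (length φ * t) (tautology i)) ++ map encodeClause (weaken w φ)
    ≡⟨ cong₂ _++_ (List.map-replicate encodeClause (length φ * t) (tautology i)) (encode-weaken w φ) ⟩
  replicate (length φ * t) (encodeClause (tautology i)) ++ map encodeClause φ
    ≡⟨ cong (λ d → replicate (length φ * t) d ++ map encodeClause φ)
         (cong (λ n → ((nil ∙ nil) ∙ encodeℕ n) ∙ ((nil ∙ encodeℕ n) ∙ nil)) i≡0) ⟩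
  replicate (length φ * t) tautologyD ++ map encodeClause φ ∎)
  where open ≡-Reasoning

-- Counting the clauses of a 3-CNF

-- Pigeonhole by induction: one occurrence of the head is cut out of `ys`, and uniqueness ensures
-- that the tail does not need it.
unique-⊆-length : ∀ {A : Set} {xs : List A} → Unique xs → ∀ ys → (∀ {x} → x ∈ xs → x ∈ ys) → length xs ≤ length ys
unique-⊆-length []           ys xs⊆ys = z≤n
unique-⊆-length {xs = x ∷ xs} (x∉xs ∷ unique) ys xs⊆ys with ∈-∃++ (xs⊆ys (here refl))
... | as , bs , refl = begin
  suc (length xs)             ≤⟨ s≤s (unique-⊆-length unique (as ++ bs) xs⊆as++bs) ⟩
  suc (length (as ++ bs))     ≡⟨ List.length-++-sucʳ as x bs ⟨
  length (as ++ x ∷ bs)       ∎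
  where
  open ≤-Reasoning
  xs⊆as++bs : ∀ {y} → y ∈ xs → y ∈ as ++ bs
  xs⊆as++bs y∈xs with ∈-++⁻ as (xs⊆ys (there y∈xs))
  ... | inj₁ y∈as            = ∈-++⁺ˡ y∈as
  ... | inj₂ (here y≡x)      = contradiction (sym y≡x) (All.lookup x∉xs y∈xs)
  ... | inj₂ (there y∈bs)    = ∈-++⁺ʳ as y∈bs

literals : ∀ n → List (Literal n)
literals n = map pos (allFin n) ++ map neg (allFin n)

∈-literals : ∀ {n} (l : Literal n) → l ∈ literals n
∈-literals {n} (pos i) = ∈-++⁺ˡ (∈-map⁺ pos (∈-allFin i))
∈-literals {n} (neg i) = ∈-++⁺ʳ (map pos (allFin n)) (∈-map⁺ neg (∈-allFin i))

length-literals : ∀ n → length (literals n) ≡ n + n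
length-literals n = trans (List.length-++ (map pos (allFin n))) (cong₂ _+_ (each pos) (each neg))
  where
  each : (f : Fin n → Literal n) → length (map f (allFin n)) ≡ n
  each f = trans (List.length-map f (allFin n)) (List.length-tabulate id)

clausesUpTo : ∀ n → ℕ → List (Clause n)
clausesUpTo n zero    = [] ∷ []
clausesUpTo n (suc j) = [] ∷ cartesianProductWith _∷_ (literals n) (clausesUpTo n j)

∈-clausesUpTo : ∀ {n j} (C : Clause n) → length C ≤ j → C ∈ clausesUpTo n j
∈-clausesUpTo {j = zero}  []      _         = here refl
∈-clausesUpTo {j = suc j} []      _         = here refl
∈-clausesUpTo {j = suc j} (l ∷ C) (s≤s C≤j) = there (∈-cartesianProductWith⁺ _∷_ (∈-literals l) (∈-clausesUpTo C C≤j))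

length-cartesianProductWith : ∀ {A B C : Set} (f : A → B → C) xs ys →
  length (cartesianProductWith f xs ys) ≡ length xs * length ys
length-cartesianProductWith f []       ys = refl
length-cartesianProductWith f (x ∷ xs) ys = trans (List.length-++ (map (f x) ys))
  (cong₂ _+_ (List.length-map (f x) ys) (length-cartesianProductWith f xs ys))

length-clausesUpTo : ∀ n j → length (clausesUpTo n j) ≤ suc (n + n) ^ j
length-clausesUpTo n zero    = ≤-refl
length-clausesUpTo n (suc j) = begin
  suc (length (cartesianProductWith _∷_ (literals n) (clausesUpTo n j)))
    ≡⟨ cong suc (length-cartesianProductWith _∷_ (literals n) (clausesUpTo n j)) ⟩
  suc (length (literals n) * length (clausesUpTo n j))
    ≡⟨ cong (λ k → suc (k * length (clausesUpTo n j))) (length-literals n) ⟩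
  suc ((n + n) * length (clausesUpTo n j))
    ≤⟨ +-mono-≤ (m^n>0 (suc (n + n)) j) (*-monoʳ-≤ (n + n) (length-clausesUpTo n j)) ⟩
  suc (n + n) ^ suc j ∎
  where open ≤-Reasoning

-- `ETH` measures time in `m` alone, whereas the algorithm may use time polynomial in the size of
-- its input; this bound links the two.
3CNF-length : ∀ {m} {φ : CNF m} → 3CNF φ → length φ ≤ suc (m + m) ^ 3
3CNF-length {m} {φ} (short , unique) = ≤-trans
  (unique-⊆-length unique (clausesUpTo m 3) λ {C} C∈φ → ∈-clausesUpTo C (All.lookup short C∈φ))
  (length-clausesUpTo m 3)

3CNF-size : ∀ {m} {φ : CNF m} → 3CNF φ → size φ ≤ length φ * 4
3CNF-size (short , _) = go short
  where
  go : ∀ {m} {φ : CNF m} → All (λ C → length C ≤ 3) φ → size φ ≤ length φ * 4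
  go []         = z≤n
  go (C≤3 ∷ φ≤) = +-mono-≤ (s≤s C≤3) (go φ≤)

-- Reals

lower<upper : ∀ x {q r} → q ℚ<ℝ x → x ℝ<ℚ r → q ℚ.< r
lower<upper x {q} {r} q<x x<r with ℚ.<-cmp q r
... | tri< q<r _ _  = q<r
... | tri≈ _ refl _ = contradiction (q<x , x<r) (disjoint x q)
... | tri> _ _ r<q  = contradiction (Equivalence.from (roundedˡ x r) (q , r<q , q<x) , x<r) (disjoint x r)

-- A positive rational below `c` is at least the reciprocal of its own denominator `suc k`, so every
-- p / q above `c` exceeds 1 / suc k. From here on, `c` is used only through this reciprocal.
reciprocal-below : ∀ c → 0ℚ ℚ<ℝ c → ∃ λ k → ∀ p q .{{_ : NonZero q}} → c ℝ<ℚ (+ p / q) → q ≤ p * suc k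
reciprocal-below c 0<c with Equivalence.to (roundedˡ c 0ℚ) 0<c
... | r , 0<r , r<c = ℚ.denominator-1 r , below r 0<r r<c
  where
  below : ∀ r → 0ℚ ℚ.< r → r ℚ<ℝ c → ∀ p q .{{_ : NonZero q}} → c ℝ<ℚ (+ p / q) → q ≤ p * suc (ℚ.denominator-1 r)
  below (mkℚ (+ zero) b _) (ℚ.*<* 0<0) r<c p q c<p/q = contradiction 0<0 (ℤ.<-irrefl refl)
  below (mkℚ -[1+ a ] b _) (ℚ.*<* ())  r<c p q c<p/q
  below r@(mkℚ (+ suc a) b _) 0<r      r<c p (suc q) c<p/q = ≤-trans (m≤n*m (suc q) (suc a)) (<⇒≤ a*q<p*b)
    where
    a*q<p*b : suc a * suc q < p * suc b
    a*q<p*b with ℚᵘ.*<* lt ← ℚᵘ.<-respʳ-≃ (ℚ.toℚᵘ-fromℚᵘ (mkℚᵘ (+ p) q)) (ℚ.toℚᵘ-mono-< (lower<upper c r<c c<p/q)) =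
      ℤ.drop‿+<+ (subst₂ ℤ._<_ (sym (ℤ.pos-* (suc a) (suc q))) (sym (ℤ.pos-* p (suc b))) lt)

-- Here `suc t` is the denominator of `s`, and a numerator below it is at most `t`. The bound t / (t
-- + 1) is the share of tautologies once `t` of them are added per clause.
fraction-below-1 : ∀ s → s ℚ.< 1ℚ → ∃ λ t → toℚᵘ s ℚᵘ.≤ mkℚᵘ (+ t) t
fraction-below-1 (mkℚ n t _) (ℚ.*<* n<t) = t , ℚᵘ.*≤* (ℤ.*-monoʳ-≤-nonNeg (+ suc t) n≤t)
  where
  n≤t : n ℤ.≤ + t
  n≤t with subst₂ ℤ._<_ (ℤ.*-identityʳ n) (ℤ.*-identityˡ (+ suc t)) n<t
  ... | ℤ.-<+           = ℤ.-≤+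
  ... | ℤ.+<+ (s≤s a≤t) = ℤ.+≤+ a≤t

scaled-≤ : ∀ r t → toℚᵘ r ℚᵘ.≤ mkℚᵘ (+ t) t → ∀ l n → l * t ≤ n → r ℚ.* (+ (l * suc t) / 1) ℚ.≤ + n / 1
scaled-≤ r t r≤ l n l*t≤n = ℚ.toℚᵘ-cancel-≤ (begin
  toℚᵘ (r ℚ.* (+ (l * suc t) / 1))                ≃⟨ ℚ.toℚᵘ-homo-* r (+ (l * suc t) / 1) ⟩
  toℚᵘ r ℚᵘ.* toℚᵘ (+ (l * suc t) / 1)            ≃⟨ ℚᵘ.*-congˡ {toℚᵘ r} (ℚ.toℚᵘ-fromℚᵘ (mkℚᵘ (+ (l * suc t)) 0)) ⟩
  toℚᵘ r ℚᵘ.* mkℚᵘ (+ (l * suc t)) 0              ≤⟨ ℚᵘ.*-monoˡ-≤-nonNeg (mkℚᵘ (+ (l * suc t)) 0) r≤ ⟩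
  mkℚᵘ (+ t) t ℚᵘ.* mkℚᵘ (+ (l * suc t)) 0        ≤⟨ ℚᵘ.*≤* (subst₂ ℤ._≤_ lhs rhs (ℤ.+≤+ in-ℕ)) ⟩
  mkℚᵘ (+ n) 0                                    ≃⟨ ℚ.toℚᵘ-fromℚᵘ (mkℚᵘ (+ n) 0) ⟨
  toℚᵘ (+ n / 1)                                  ∎)
  where
  open ℚᵘ.≤-Reasoning
  in-ℕ : t * (l * suc t) ≤ n * suc t
  in-ℕ = subst (_≤ n * suc t) (trans (cong (_* suc t) (*-comm l t)) (*-assoc t l (suc t))) (*-monoˡ-≤ (suc t) l*t≤n)
  lhs : + (t * (l * suc t)) ≡ + t ℤ.* + (l * suc t) ℤ.* + 1
  lhs = trans (ℤ.pos-* t (l * suc t)) (sym (ℤ.*-identityʳ _))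
  rhs : + (n * suc t) ≡ + n ℤ.* + (suc t * 1)
  rhs = trans (cong (λ k → + (n * k)) (sym (*-identityʳ (suc t)))) (ℤ.pos-* n (suc t * 1))

-- Roundedness leaves room for a rational `s` between `x` and `u`. It is chosen before `r`, which
-- makes the number of tautologies per clause uniform in `r`.
⊕-upper : ∀ q x {u} → x ℝ<ℚ u → ∃ λ s → s ℚ.< u × (∀ r → r ℚ<ℝ q ⊕ x → r ℚ.< s ℚ.+ q)
⊕-upper q x {u} x<u with Equivalence.to (roundedᵘ x u) x<u
... | s , s<u , x<s = s , s<u , λ r r<q+x →
  subst (ℚ._< s ℚ.+ q) (cancel r) (ℚ.+-monoˡ-< q (lower<upper x r<q+x x<s))
  where
  cancel : ∀ r → r ℚ.- q ℚ.+ q ≡ r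
  cancel r = trans (ℚ.+-assoc r (ℚ.- q) q) (trans (cong (r ℚ.+_) (ℚ.+-inverseˡ q)) (ℚ.+-identityʳ r))

⊕-below-1 : ∀ q x {u} → u ℚ.+ q ≡ 1ℚ → x ℝ<ℚ u →
  ∃ λ t → ∀ r → r ℚ<ℝ q ⊕ x → toℚᵘ r ℚᵘ.≤ mkℚᵘ (+ t) t
⊕-below-1 q x u+q≡1 x<u =
  let s , s<u , below = ⊕-upper q x x<u
      t , s+q≤ = fraction-below-1 (s ℚ.+ q) (subst (s ℚ.+ q ℚ.<_) u+q≡1 (ℚ.+-monoˡ-< q s<u))
  in t , λ r r<q+x → ℚᵘ.≤-trans (ℚ.toℚᵘ-mono-≤ (ℚ.<⇒≤ (below r r<q+x))) s+q≤

⊕-satisfiable : ∀ q x {u} → u ℚ.+ q ≡ 1ℚ → x ℝ<ℚ u → ∃ λ t →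
  ∀ {n} (φ : CNF n) v l → length φ ≡ l * suc t → l * t ≤ #satisfiedClauses v φ → (q ⊕ x) -Satisfiable φ
⊕-satisfiable q x u+q≡1 x<u = let t , below = ⊕-below-1 q x u+q≡1 x<u in
  t , λ φ v l φ≡ l*t≤ → v , λ r r<q+x →
    subst (λ k → r ℚ.* (+ k / 1) ℚ.≤ + #satisfiedClauses v φ / 1) (sym φ≡)
      (scaled-≤ r t (below r r<q+x) l _ l*t≤)

-- Arithmetic of the reduction

^-distribʳ-* : ∀ o m n → (m * n) ^ o ≡ m ^ o * n ^ o
^-distribʳ-* zero    m n = refl
^-distribʳ-* (suc o) m n = trans (cong (m * n *_) (^-distribʳ-* o m n)) (interchange m n (m ^ o) (n ^ o))

^-cancelˡ-≤ : ∀ o .{{_ : NonZero o}} {m n} → m ^ o ≤ n ^ o → m ≤ n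
^-cancelˡ-≤ o {m} {n} m^o≤n^o = ≮⇒≥ λ n<m → <⇒≱ (^-monoˡ-< o n<m) m^o≤n^o

-- With y = ⌊ x / d ⌋, one has x + 1 ≤ d (y + 1) ≤ d 2 ^ y; the d-th power of this is the claim, as
-- y d ≤ x.
suc-^-≤-2^ : ∀ d .{{_ : NonZero d}} x → suc x ^ d ≤ d ^ d * 2 ^ x
suc-^-≤-2^ d x = begin
  suc x ^ d              ≤⟨ ^-monoˡ-≤ d suc-x≤ ⟩
  (d * 2 ^ y) ^ d        ≡⟨ ^-distribʳ-* d d (2 ^ y) ⟩
  d ^ d * (2 ^ y) ^ d    ≡⟨ cong (d ^ d *_) (^-*-assoc 2 y d) ⟩
  d ^ d * 2 ^ (y * d)    ≤⟨ *-monoʳ-≤ (d ^ d) (^-monoʳ-≤ 2 (m/n*n≤m x d)) ⟩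
  d ^ d * 2 ^ x          ∎
  where
  open ≤-Reasoning
  y = x ℕ./ d
  suc-x≤ : suc x ≤ d * 2 ^ y
  suc-x≤ = begin
    suc x                      ≡⟨ cong suc (m≡m%n+[m/n]*n x d) ⟩
    suc (x ℕ.% d) + y * d      ≤⟨ +-monoˡ-≤ (y * d) (m%n<n x d) ⟩
    suc y * d                  ≤⟨ *-monoˡ-≤ d (n<2^n y) ⟩
    2 ^ y * d                  ≡⟨ *-comm (2 ^ y) d ⟩
    d * 2 ^ y                  ∎

-- If the bit length is j + 1, the stride is j + 2 and 2 ^ j ≤ m. The factor 2 makes up for the
-- exponent j + 1 that the previous bound yields.
stride-poly : ∀ d .{{_ : NonZero d}} m .{{_ : NonZero m}} → stride m ^ d ≤ 2 * d ^ d * m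
stride-poly d m with bitLength m | bitLength-upper m | bitLength-lower m
... | zero  | m<1 | lower = contradiction (n<1⇒n≡0 m<1) (≢-nonZero⁻¹ m)
... | suc j | _   | lower = begin
  suc (suc j) ^ d          ≤⟨ suc-^-≤-2^ d (suc j) ⟩
  d ^ d * (2 * 2 ^ j)      ≡⟨ *-assoc (d ^ d) 2 (2 ^ j) ⟨
  d ^ d * 2 * 2 ^ j        ≡⟨ cong (_* 2 ^ j) (*-comm (d ^ d) 2) ⟩
  2 * d ^ d * 2 ^ j        ≤⟨ *-monoʳ-≤ (2 * d ^ d) (lower j ≤-refl) ⟩
  2 * d ^ d * m            ∎
  where open ≤-Reasoning

rounds*stride≤ : ∀ m → rounds m * stride m ≤ m + stride m
rounds*stride≤ m with rounds m | rounds-lower m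
... | zero  | _     = z≤n
... | suc i | lower = ≤-trans (+-monoʳ-≤ (stride m) (<⇒≤ (lower i ≤-refl))) (≤-reflexive (+-comm (stride m) m))

growth : ℕ → ℕ
growth q = 2 * suc q ^ suc q

-- Raise m ≤ u g to the power q + 1, bound g ^ (q + 1) by C m with `stride-poly`, and cancel one
-- factor m. As C ≥ 1, it may be moved under the power.
rounds-large : ∀ q .{{_ : NonZero q}} m → m ^ q ≤ (growth q * rounds m) ^ suc q
rounds-large (suc q) zero = z≤n
rounds-large q m@(suc _) = *-cancelˡ-≤ m (begin
  m ^ suc q                                ≤⟨ ^-monoˡ-≤ (suc q) (rounds-upper m) ⟩
  (rounds m * stride m) ^ suc q              ≡⟨ ^-distribʳ-* (suc q) (rounds m) (stride m) ⟩
  rounds m ^ suc q * stride m ^ suc q        ≤⟨ *-mono-≤ (^-monoˡ-≤ (suc q) (≤-refl {rounds m})) (stride-poly (suc q) m) ⟩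
  rounds m ^ suc q * (C * m)               ≡⟨ *-assoc (rounds m ^ suc q) C m ⟨
  rounds m ^ suc q * C * m                 ≡⟨ cong (_* m) (*-comm (rounds m ^ suc q) C) ⟩
  C * rounds m ^ suc q * m                 ≤⟨ *-monoˡ-≤ m (*-monoˡ-≤ (rounds m ^ suc q) C≤C^) ⟩
  C ^ suc q * rounds m ^ suc q * m         ≡⟨ cong (_* m) (^-distribʳ-* (suc q) C (rounds m)) ⟨
  (C * rounds m) ^ suc q * m               ≡⟨ *-comm _ m ⟩
  m * (C * rounds m) ^ suc q               ∎)
  where
  open ≤-Reasoning
  C = growth q
  instance
    C≢0 : NonZero C
    C≢0 = m*n≢0 2 (suc q ^ suc q) {{_}} {{m^n≢0 (suc q) (suc q)}}
  C≤C^ : C ≤ C ^ suc q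
  C≤C^ = m≤m*n C (C ^ q) {{m^n≢0 C q}}

-- From m ≤ k ^ (1 + 1/r) ≤ (log n) ^ (1 + p/q) ≤ e / f, where r⁻¹ ≤ p / q.
Power≤⇒≤ : ∀ r .{{_ : NonZero r}} m k {a b p q e f} .{{_ : NonZero b}} .{{_ : NonZero q}} →
  m ^ r ≤ k ^ suc r → q ≤ p * r → k * b ≤ a → Power≤ a b p q e f → m * f ≤ e
Power≤⇒≤ r@(suc _) zero _ _ _ _ _ = z≤n
Power≤⇒≤ r@(suc _) m@(suc _) zero m^r≤0 _ _ _ = contradiction (n≤0⇒n≡0 m^r≤0) (≢-nonZero⁻¹ (m ^ r) {{m^n≢0 m r}})
Power≤⇒≤ r m k@(suc _) {a} {b} {p} {q} {e} {f} m^r≤ q≤pr kb≤a power =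
  ^-cancelˡ-≤ q (*-cancelʳ-≤ _ _ (b ^ (p + q)) {{m^n≢0 b (p + q)}} (begin
    (m * f) ^ q * b ^ (p + q)              ≡⟨ cong (_* b ^ (p + q)) (^-distribʳ-* q m f) ⟩
    m ^ q * f ^ q * b ^ (p + q)            ≤⟨ *-monoˡ-≤ (b ^ (p + q)) (*-monoˡ-≤ (f ^ q) m^q≤) ⟩
    k ^ (p + q) * f ^ q * b ^ (p + q)      ≡⟨ *-assoc (k ^ (p + q)) _ _ ⟩
    k ^ (p + q) * (f ^ q * b ^ (p + q))    ≡⟨ cong (k ^ (p + q) *_) (*-comm (f ^ q) _) ⟩
    k ^ (p + q) * (b ^ (p + q) * f ^ q)    ≡⟨ *-assoc (k ^ (p + q)) _ _ ⟨
    k ^ (p + q) * b ^ (p + q) * f ^ q      ≡⟨ cong (_* f ^ q) (^-distribʳ-* (p + q) k b) ⟨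
    (k * b) ^ (p + q) * f ^ q              ≤⟨ *-monoˡ-≤ (f ^ q) (^-monoˡ-≤ (p + q) kb≤a) ⟩
    a ^ (p + q) * f ^ q                    ≤⟨ power ⟩
    e ^ q * b ^ (p + q)                    ∎))
  where
  open ≤-Reasoning
  m^q≤ : m ^ q ≤ k ^ (p + q)
  m^q≤ = ^-cancelˡ-≤ r (begin
    (m ^ q) ^ r              ≡⟨ ^-*-assoc m q r ⟩
    m ^ (q * r)              ≡⟨ cong (m ^_) (*-comm q r) ⟩
    m ^ (r * q)              ≡⟨ ^-*-assoc m r q ⟨
    (m ^ r) ^ q              ≤⟨ ^-monoˡ-≤ q m^r≤ ⟩
    (k ^ suc r) ^ q          ≡⟨ ^-*-assoc k (suc r) q ⟩
    k ^ (q + r * q)          ≤⟨ ^-monoʳ-≤ k (+-mono-≤ q≤pr (≤-reflexive (*-comm r q))) ⟩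
    k ^ (p * r + q * r)      ≡⟨ cong (k ^_) (*-distribʳ-+ r p q) ⟨
    k ^ ((p + q) * r)        ≡⟨ ^-*-assoc k (p + q) r ⟨
    (k ^ (p + q)) ^ r        ∎)

Above-log₂⇒≤ : ∀ {n a b} k → 2 ^ k ≤ n → Above-log₂ n a b → k * b ≤ a
Above-log₂⇒≤ {n} {a} {b} k 2^k≤n n^b<2^a = ≮⇒≥ λ a<kb → <⇒≱ n^b<2^a (begin
  2 ^ a          ≤⟨ ^-monoʳ-≤ 2 (<⇒≤ a<kb) ⟩
  2 ^ (k * b)    ≡⟨ ^-*-assoc 2 k b ⟨
  (2 ^ k) ^ b    ≤⟨ ^-monoˡ-≤ b 2^k≤n ⟩
  n ^ b          ∎)
  where open ≤-Reasoning

-- With n = m + w and u = e / f, the required 2 ^ (n - u) is at most 2 ^ w as soon as m ≤ u. That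
-- holds because k ≤ log w ≤ log n and m ≤ k ^ (1 + 1/r).
many-assignments : ∀ c r .{{_ : NonZero r}} →
  (∀ p q .{{_ : NonZero q}} → c ℝ<ℚ (+ p / q) → q ≤ p * r) →
  ∀ m w k → m ^ r ≤ k ^ suc r → 2 ^ k ≤ w → ∀ N → 2 ^ w ≤ N → 2^[ m + w -log^1+ c ]≤ N
many-assignments c r r-large m w k m^r≤ 2^k≤w N 2^w≤N a b p q e f above c<p/q power = begin
  2 ^ ((m + w) * f)             ≡⟨ cong (2 ^_) (trans (*-distribʳ-+ f m w) (+-comm (m * f) (w * f))) ⟩
  2 ^ (w * f + m * f)           ≡⟨ ^-distribˡ-+-* 2 (w * f) (m * f) ⟩
  2 ^ (w * f) * 2 ^ (m * f)     ≡⟨ cong (_* 2 ^ (m * f)) (^-*-assoc 2 w f) ⟨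
  (2 ^ w) ^ f * 2 ^ (m * f)     ≤⟨ *-mono-≤ (^-monoˡ-≤ f 2^w≤N) (^-monoʳ-≤ 2 mf≤e) ⟩
  N ^ f * 2 ^ e                 ∎
  where
  open ≤-Reasoning
  mf≤e : m * f ≤ e
  mf≤e = Power≤⇒≤ r m k {a} {b} {p} {q} {e} {f} m^r≤ (r-large p q c<p/q)
    (Above-log₂⇒≤ k (≤-trans 2^k≤w (m≤n+m w m)) above) power

-- `2 ^ rounds m` pays for the dummy variables and `2 ^ stride m`, which exceeds `m`, for the
-- formula; a fixed power of their product bounds the whole running time.
exponent : ℕ → ℕ
exponent m = rounds m + stride m

-- With g = stride m, exponent m * g ≤ m + g + g * g ≤ 17 * m: `stride-poly` at d = 2 gives g * g ≤
-- 8 * m, and 17 = 1 + 8 + 8. So the exponent is O(m / g), and m ≥ 2 ^ A forces g ≥ A, which absorbs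
-- `k * c` together with the 17.
exponent-o : ∀ c → o[id] λ m → exponent m * c
exponent-o c k = 2 ^ A , λ m 2^A≤m → bound m 2^A≤m {{>-nonZero (≤-trans (m^n>0 2 A) 2^A≤m)}}
  where
  A = k * c * 17
  open ≤-Reasoning
  bound : ∀ m → 2 ^ A ≤ m → .{{_ : NonZero m}} → k * (exponent m * c) ≤ m
  bound m 2^A≤m = *-cancelʳ-≤ _ _ 17 (begin
    k * (exponent m * c) * 17          ≡⟨ cong (_* 17) (trans (cong (k *_) (*-comm (exponent m) c)) (sym (*-assoc k c _))) ⟩
    k * c * exponent m * 17            ≡⟨ trans (*-assoc (k * c) _ 17) (trans (cong (k * c *_) (*-comm (exponent m) 17))
                                            (sym (*-assoc (k * c) 17 _))) ⟩
    A * exponent m                     ≤⟨ *-monoˡ-≤ (exponent m) A≤stride ⟩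
    g * exponent m                     ≡⟨ *-comm g (exponent m) ⟩
    (rounds m + g) * g                 ≡⟨ *-distribʳ-+ g (rounds m) g ⟩
    rounds m * g + g * g               ≤⟨ +-monoˡ-≤ (g * g) (rounds*stride≤ m) ⟩
    m + g + g * g                      ≡⟨ +-assoc m g (g * g) ⟩
    m + (g + g * g)                    ≤⟨ +-monoʳ-≤ m (+-mono-≤ (≤-trans (m≤m*n g g) g²≤) g²≤) ⟩
    m + (8 * m + 8 * m)                ≡⟨ cong (λ n → m + n) (sym (*-distribʳ-+ m 8 8)) ⟩
    17 * m                             ≡⟨ *-comm 17 m ⟩
    m * 17                             ∎)
    where
    g = stride m
    g²≤ : g * g ≤ 8 * m
    g²≤ = ≤-trans (≤-reflexive (cong (g *_) (sym (*-identityʳ g)))) (stride-poly 2 m)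
    A≤stride : A ≤ g
    A≤stride = ≮⇒≥ λ g<A → <⇒≱ (bitLength-upper m)
      (≤-trans (^-monoʳ-≤ 2 (≤-trans (n≤1+n _) (<⇒≤ g<A))) 2^A≤m)

-- Running times polynomial in a common base

module PolynomialBounds {A : Set} (X : A → ℕ) (2≤X : ∀ a → 2 ≤ X a) where

  -- A bare power is enough to express polynomial growth: as the base is at least 2, constants and
  -- sums are absorbed by a larger exponent.
  Bounded : (A → ℕ) → Set
  Bounded Q = ∃ λ c → ∀ a → Q a ≤ X a ^ c

  private instance
    X≢0 : ∀ {a} → NonZero (X a)
    X≢0 {a} = >-nonZero (≤-trans (s≤s z≤n) (2≤X a))

  infixl 6 _⊞_
  infixl 7 _⊠_

  bounded-≤ : ∀ {Q R} → (∀ a → Q a ≤ R a) → Bounded R → Bounded Q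
  bounded-≤ Q≤R (c , R≤) = c , λ a → ≤-trans (Q≤R a) (R≤ a)

  bounded-X : ∀ {Q} → (∀ a → Q a ≤ X a) → Bounded Q
  bounded-X Q≤X = 1 , λ a → ≤-trans (Q≤X a) (≤-reflexive (sym (*-identityʳ (X a))))

  bounded-const : ∀ n → Bounded λ _ → n
  bounded-const n = n , λ a → ≤-trans (<⇒≤ (n<2^n n)) (^-monoˡ-≤ n (2≤X a))

  _⊠_ : ∀ {Q R} → Bounded Q → Bounded R → Bounded λ a → Q a * R a
  (c , Q≤) ⊠ (d , R≤) = c + d , λ a →
    ≤-trans (*-mono-≤ (Q≤ a) (R≤ a)) (≤-reflexive (sym (^-distribˡ-+-* (X a) c d)))

  _⊞_ : ∀ {Q R} → Bounded Q → Bounded R → Bounded λ a → Q a + R a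
  _⊞_ {Q} {R} (c , Q≤) (d , R≤) = suc (c + d) , λ a → begin
    Q a + R a                        ≤⟨ +-mono-≤ (≤-trans (Q≤ a) (^-monoʳ-≤ (X a) (m≤m+n c d)))
                                                 (≤-trans (R≤ a) (^-monoʳ-≤ (X a) (m≤n+m d c))) ⟩
    X a ^ (c + d) + X a ^ (c + d)    ≡⟨ cong (λ x → X a ^ (c + d) + x) (+-identityʳ _) ⟨
    2 * X a ^ (c + d)                ≤⟨ *-monoˡ-≤ (X a ^ (c + d)) (2≤X a) ⟩
    X a ^ suc (c + d)                ∎
    where open ≤-Reasoning

  bounded-^ : ∀ {Q} n → Bounded Q → Bounded λ a → Q a ^ n
  bounded-^ zero    Q≤ = bounded-const 1
  bounded-^ (suc n) Q≤ = Q≤ ⊠ bounded-^ n Q≤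

  bounded-forEachCost : ∀ e f {Q} → Bounded Q → Bounded λ a → forEachCost e f (Q a)
  bounded-forEachCost e f Q≤ = bounded-const (suc (cost e)) ⊞
    (Q≤ ⊠ bounded-const (2 + (suc (cost f) + 3)) ⊞ bounded-const 2)

-- The proof of `3CNF` is part of the index because the bounds on length and size depend on it.
3CNFs : Set
3CNFs = ∃ λ m → ∃ λ (φ : CNF m) → 3CNF φ

timeBase : 3CNFs → ℕ
timeBase (m , _) = 2 ^ exponent m

open PolynomialBounds timeBase
  (λ (m , _) → ^-monoʳ-≤ 2 {1} (≤-trans (s≤s z≤n) (m≤n+m (stride m) (rounds m))))

runningTime : ℕ → ℕ → ℕ → 3CNFs → ℕ
runningTime k t K (m , φ , _) =
  preprocessCost k t m (length φ) +
  (K * (m + suc k ^ rounds m + (length φ * t * 3 + size φ)) ^ K + K)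

bounded-runningTime : ∀ k t K → Bounded (runningTime k t K)
bounded-runningTime k t K =
  (const 3 ⊞ (const 4 ⊞ (const 4 ⊞ (bounded-logLoop ⊞
  (const 3 ⊞ (const 4 ⊞ (bounded-growLoop ⊞
  (forEachCost≤ (hd (var 0)) (cons nil (var 2)) bounded-m ⊞ (const 3 ⊞
  (forEachCost≤ (var 3) (prependExpr t tautologyExpr (var 3)) bounded-length ⊞
  -- The last four assignments of `preprocess` cost 4 + 2 + 2 + 2.
  const 10)))))))))) ⊞
  (const K ⊠ bounded-^ K (bounded-m ⊞ bounded-w ⊞ (bounded-length ⊠ const t ⊠ const 3 ⊞ bounded-size)) ⊞ const K)
  where
  const = bounded-const
  forEachCost≤ = bounded-forEachCost

  bounded-rounds : Bounded λ (m , _) → rounds m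
  bounded-rounds = bounded-X λ (m , _) → ≤-trans (<⇒≤ (n<2^n (rounds m))) (^-monoʳ-≤ 2 (m≤m+n (rounds m) (stride m)))

  bounded-stride : Bounded λ (m , _) → stride m
  bounded-stride = bounded-X λ (m , _) → ≤-trans (<⇒≤ (n<2^n (stride m))) (^-monoʳ-≤ 2 (m≤n+m (stride m) (rounds m)))

  bounded-bitLength : Bounded λ (m , _) → bitLength m
  bounded-bitLength = bounded-≤ (λ _ → n≤1+n _) bounded-stride

  bounded-m : Bounded λ (m , _) → m
  bounded-m = bounded-X λ (m , _) →
    ≤-trans (<⇒≤ (bitLength-upper m)) (^-monoʳ-≤ 2 (≤-trans (n≤1+n _) (m≤n+m (stride m) (rounds m))))

  bounded-w : Bounded λ (m , _) → suc k ^ rounds m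
  bounded-w = suc k , λ (m , _) → begin
    suc k ^ rounds m            ≤⟨ ^-monoˡ-≤ (rounds m) (<⇒≤ (n<2^n (suc k))) ⟩
    (2 ^ suc k) ^ rounds m      ≡⟨ ^-*-assoc 2 (suc k) (rounds m) ⟩
    2 ^ (suc k * rounds m)      ≡⟨ cong (2 ^_) (*-comm (suc k) (rounds m)) ⟩
    2 ^ (rounds m * suc k)      ≤⟨ ^-monoʳ-≤ 2 (*-monoˡ-≤ (suc k) (m≤m+n (rounds m) (stride m))) ⟩
    2 ^ (exponent m * suc k)    ≡⟨ ^-*-assoc 2 (exponent m) (suc k) ⟨
    (2 ^ exponent m) ^ suc k    ∎
    where open ≤-Reasoning

  bounded-length : Bounded λ (m , φ , _) → length φ
  bounded-length = bounded-≤ (λ (_ , _ , 3cnf) → 3CNF-length 3cnf)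
    (bounded-^ 3 (const 1 ⊞ (bounded-m ⊞ bounded-m)))

  bounded-size : Bounded λ (m , φ , _) → size φ
  bounded-size = bounded-≤ (λ (_ , _ , 3cnf) → 3CNF-size 3cnf) (bounded-length ⊠ const 4)

  bounded-logLoop : Bounded λ (m , _) → logLoopCost m
  bounded-logLoop = bounded-bitLength ⊠
    (const 2 ⊞ (forEachCost≤ (var 2) (tl (var 1)) bounded-m ⊞
      (forEachCost≤ (var 2) (cons nil (var 2)) bounded-m ⊞ const 4))) ⊞ const 2

  bounded-growLoop : Bounded λ (m , _) → growLoopCost k m
  bounded-growLoop = bounded-rounds ⊠
    (const 2 ⊞ (forEachCost≤ (var 3) (tl (var 1)) bounded-stride ⊞
      forEachCost≤ (var 2) (prependExpr k nil (var 2)) bounded-w)) ⊞ const 2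


-- The reduction from 3-SAT

no-polynomial-time-algorithm : ETH → ∀ c α r t .{{_ : NonZero r}} →
  (∀ p q .{{_ : NonZero q}} → c ℝ<ℚ (+ p / q) → q ≤ p * r) →
  (∀ {n} (φ : CNF n) v l → length φ ≡ l * suc t → l * t ≤ #satisfiedClauses v φ → α -Satisfiable φ) →
  ¬ ∃ λ P → SolvesInPolynomialTime P
    (λ n φ → 1 ≤ n × SAT n (2^[ n -log^1+ c ]≤_) φ × α -Satisfiable φ)
no-polynomial-time-algorithm eth c α r t r-large t-satisfiable (P , K , solves) =
  eth (preprocess k t ⨾ P , (λ m → exponent m * d) , exponent-o d , decides)
  where
  C = growth r
  -- `growLoop` multiplies by `suc k`, so this choice makes log w at least `C * rounds m`, the
  -- quantity that `rounds-large` compares with `m`.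
  k = 2 ^ C
  d = proj₁ (bounded-runningTime k t K)

  decides : ∀ m (φ : CNF m) → 3CNF φ →
    Answers (preprocess k t ⨾ P) (encode φ) (2 ^ (exponent m * d)) (Satisfiable φ)
  decides m φ 3cnf =
    let τ , s , p , s≤ , answer = solves (m + w) ψ (0<n , promise , satisfiable)
        τ′ , s′ , p′ , s′≤ , τ′≗τ = preprocessing ⨟ (τ , s , p , s≤ , λ _ → refl)
    in τ′ , s′ , p′ , ≤-trans s′≤ time≤
     , mk⇔ (λ τ′0≢nil → Equivalence.to ψ⇔φ (Equivalence.to answer (τ′0≢nil ∘ trans (τ′≗τ 0))))
           (λ sat-φ τ′0≡nil → Equivalence.from answer (Equivalence.from ψ⇔φ sat-φ) (trans (sym (τ′≗τ 0)) τ′0≡nil))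
    where
    w = suc k ^ rounds m

    -- Even for `m = 0` there is a dummy variable, since `w` is a power of `suc k`; hence variable 0
    -- exists and can carry the tautologies.
    0<n : 0 < m + w
    0<n = ≤-trans (m^n>0 (suc k) (rounds m)) (m≤n+m w m)

    i = fromℕ< 0<n
    ψ = padded w i t φ

    ψ⇔φ : Satisfiable ψ ⇔ Satisfiable φ
    ψ⇔φ = satisfiable-padded w i t φ

    2^Cu≤w : 2 ^ (C * rounds m) ≤ w
    2^Cu≤w = ≤-trans (≤-reflexive (sym (^-*-assoc 2 C (rounds m)))) (^-monoˡ-≤ (rounds m) (n≤1+n k))

    promise : SAT (m + w) (2^[ m + w -log^1+ c ]≤_) ψ
    promise with satisfiable? φ
    ... | yes sat  = inj₂ (many-assignments c r r-large m w (C * rounds m) (rounds-large r m) 2^Cu≤w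
                       (#sat ψ) (#sat-padded w i t φ sat))
    ... | no unsat = inj₁ (unsat ∘ Equivalence.to ψ⇔φ)

    -- The tautologies alone reach the required fraction, so any assignment would do.
    satisfiable : α -Satisfiable ψ
    satisfiable = t-satisfiable ψ (Vec.replicate (m + w) true) (length φ)
      (length-padded w i t φ) (#satisfiedClauses-padded w i t φ _)

    preprocessing : Runs (preprocess k t) (initial (encode φ)) (initial (encode ψ)) (preprocessCost k t m (length φ))
    preprocessing = subst₂ (λ l e → Runs (preprocess k t) (initial (encode φ)) (initial e) (preprocessCost k t m l))
      (List.length-map encodeClause φ)
      (trans (cong (λ l → encodeℕ (m + w) ∙ encodeList (replicate (l * t) tautologyD ++ map encodeClause φ))
               (List.length-map encodeClause φ))
        (sym (encode-padded w i t φ (Fin.toℕ-fromℕ< 0<n))))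
      (runs-preprocess k t m (map encodeClause φ))

    time≤ : preprocessCost k t m (length φ) + (K * (m + w + size ψ) ^ K + K) ≤ 2 ^ (exponent m * d)
    time≤ = begin
      preprocessCost k t m (length φ) + (K * (m + w + size ψ) ^ K + K)
        ≡⟨ cong (λ s → preprocessCost k t m (length φ) + (K * (m + w + s) ^ K + K)) (size-padded w i t φ) ⟩
      runningTime k t K (m , φ , 3cnf)
        ≤⟨ proj₂ (bounded-runningTime k t K) (m , φ , 3cnf) ⟩
      (2 ^ exponent m) ^ d
        ≡⟨ ^-*-assoc 2 (exponent m) d ⟩
      2 ^ (exponent m * d) ∎
      where open ≤-Reasoning

theorem6 : ETH → (c ε : ℝ) → 0ℚ ℚ<ℝ c → 0ℚ ℚ<ℝ ε → ε ℝ<ℚ (+ 1 / 8) →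
    ¬ ∃ λ P → SolvesInPolynomialTime P
    (λ n φ → 1 ≤ n × SAT n (2^[ n -log^1+ c ]≤_) φ × ((+ 7 / 8) ⊕ ε) -Satisfiable φ)
theorem6 eth c ε 0<c _ ε<1/8 =
  -- 1 / suc k lies below `c`. The `refl` checks 1/8 + 7/8 = 1, which puts 7/8 + ε below some t / (t
  -- + 1).
  let k , k-large = reciprocal-below c 0<c
      t , t-satisfiable = ⊕-satisfiable (+ 7 / 8) ε refl ε<1/8
  in no-polynomial-time-algorithm eth c ((+ 7 / 8) ⊕ ε) (suc k) t k-large t-satisfiable
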